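{- Let $n\ge1$ and $d\ge1$ be integers. Every $d$-maximal set $S\subset[n]^\infty$ has at least $\tfrac12\,(d/\log 2d)^{2/3}$ elements.
   Context: $[n]=\{1,\dots,n\}$, $[n]^\infty$ is the set of infinite sequences over $[n]$, $\mathrm{dist}(a,b)=|\{i:a_i\ne b_i\}|$ is the Hamming distance, $\mathrm{diam}(S)=\sup_{a,b\in S}\mathrm{dist}(a,b)$. $S$ is $d$-maximal if $\mathrm{diam}(S)=d$ and $S$ is inclusion-maximal among subsets of $[n]^\infty$ of diameter $d$. $\log$ denotes the natural logarithm. -}

module Defs where

open import Level using (0ℓ)
open import Data.Nat as ℕ using (ℕ; zero; suc)
open import Data.Integer using (+_)
open import Data.Fin using (Fin)
open import Data.List using (List; length)
open import Data.List.Relation.Unary.All using (All)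
open import Data.List.Relation.Unary.Any using (Any)
open import Data.List.Relation.Unary.Unique.Propositional using (Unique)
open import Data.Product using (Σ; _×_; ∃-syntax)
open import Data.Rational as ℚ using (ℚ; _/_)
open import Relation.Binary.PropositionalEquality using (_≡_; _≢_)
open import Relation.Unary using (Pred; _∈_; _⊆_)

Seq : ℕ → Set
Seq n = ℕ → Fin n

DistGe : ∀ {n} → Seq n → Seq n → ℕ → Set
DistGe a b m = Σ (List ℕ) λ is → Unique is × All (λ i → a i ≢ b i) is × length is ≡ m

DistLe : ∀ {n} → Seq n → Seq n → ℕ → Set
DistLe a b m = (is : List ℕ) → Unique is → All (λ i → a i ≢ b i) is → length is ℕ.≤ m

-- diam(S) = d   (sup of ℕ∪{∞}-valued distances; bounded by d and attained)
HasDiam : ∀ {n} → Pred (Seq n) 0ℓ → ℕ → Set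
HasDiam S d =
  (∀ a b → a ∈ S → b ∈ S → DistLe a b d) ×
  (∃[ a ] ∃[ b ] (a ∈ S × b ∈ S × DistGe a b d))

Maximal : ∀ {n} → Pred (Seq n) 0ℓ → ℕ → Set₁
Maximal {n} S d = HasDiam S d × ((T : Pred (Seq n) 0ℓ) → S ⊆ T → HasDiam T d → T ⊆ S)

CoveredBy : ∀ {n} → Pred (Seq n) 0ℓ → ℕ → Set
CoveredBy {n} S k = Σ (List (Seq n)) λ xs → length xs ≡ k × (∀ a → a ∈ S → Any (λ x → ∀ i → x i ≡ a i) xs)

nat : ℕ → ℚ
nat m = (+ m) / 1

expTerm : ℚ → ℕ → ℚ
expTerm r zero = nat 1
expTerm r (suc j) = expTerm r j ℚ.* (r ℚ.* ((+ 1) / suc j))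

expPartial : ℚ → ℕ → ℚ
expPartial r zero = expTerm r zero
expPartial r (suc N) = expPartial r N ℚ.+ expTerm r (suc N)

-- exp(r) ≤ y  for rational r ≥ 0 (partial sums increase to exp r)
ExpLe : ℚ → ℚ → Set
ExpLe r y = ∀ N → expPartial r N ℚ.≤ y

-- k ≥ ½ (d / log 2d)^{2/3}, for k ≥ 1, d ≥ 1, i.e. 8 k^3 (log 2d)^2 ≥ d^2,
-- i.e. log(2d) ≥ x where x ≥ 0, 8k^3 x^2 = d^2, i.e. exp(r) ≤ 2d for every
-- rational r ≥ 0 with 8 k^3 r^2 ≤ d^2.
AtLeastBound : ℕ → ℕ → Set
AtLeastBound k d =
  (r : ℚ) → ℚ.0ℚ ℚ.≤ r →
  nat (8 ℕ.* k ℕ.* k ℕ.* k) ℚ.* (r ℚ.* r) ℚ.≤ nat (d ℕ.* d) →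
  ExpLe r (nat (2 ℕ.* d))

{-# OPTIONS --safe #-}
-- Let S = {A_1, …, A_k}, k ≥ 2, and let x take the letter of a uniformly random A_s at every
-- coordinate. Its mean distance to A_t is the mean of dist(A_s, A_t) over s, hence at most d − d/k.
-- Regard these choices as weights w_{is}. A basic solution of the linear system that fixes the row
-- sums and the k mean distances has at most k positive weights beyond one per coordinate, so that
-- rounding it (multiplicative weights 1 + εδ, made deterministic by conditional expectations)
-- changes the distances like a sum of k bounded independent terms. If all distances stay below d,
-- then x, altered at a coordinate where all A_s agree, is a new point at distance ≤ d from S,
-- against maximality. Otherwise the Chernoff bound gives exp(ε d/k − 2ε²k) ≤ k, and optimising ε
-- yields the theorem.
-- The conclusion is decidable, which allows classical reasoning under a double negation about
-- membership in S and about the coordinate beyond which the points agree.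
module Submission where

open import Defs
open import Algebra.Bundles using (module CommutativeRing)
open import Data.Bool.Base using (if_then_else_)
open import Data.Nat using (ℕ; _≥_)
open import Data.Nat.Base as ℕ using (zero; suc; z≤n; s≤s; _⊔_)
import Data.Nat.Properties as ℕ
open import Data.Fin using (Fin)
open import Data.Fin.Base using (zero; suc; toℕ; fromℕ<; punchIn; _↑ˡ_; _↑ʳ_; combine; remQuot)
import Data.Fin.Properties as Fin
import Data.Integer.Base as ℤ
import Data.Integer.Properties as ℤ
open import Data.List.Base using (List; []; _∷_; length; lookup; filter; upTo; applyUpTo)
open import Data.List.Properties using (length-removeAt′)
open import Data.List.Membership.Propositional using () renaming (_∈_ to _∈ₗ_)
open import Data.List.Membership.Propositional.Properties using (∈-filter⁺; ∈-upTo⁺; ∈-lookup)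
open import Data.List.Relation.Unary.All as All using (All; []; _∷_)
open import Data.List.Relation.Unary.All.Properties using (all-filter)
open import Data.List.Relation.Unary.AllPairs using ([]; _∷_)
open import Data.List.Relation.Unary.Any using (Any; here; there; index; _─_)
open import Data.List.Relation.Unary.Any.Properties using (lookup-index)
open import Data.List.Relation.Unary.Unique.Propositional using (Unique)
import Data.List.Relation.Unary.Unique.Propositional.Properties as Unique
open import Data.Product.Base using (∃; _×_; _,_; proj₁; proj₂; uncurry)
open import Data.Rational as ℚ using (ℚ; 0ℚ; 1ℚ; ½; _+_; _*_; _-_; -_; _/_; _≤_; _<_; 1/_; toℚᵘ)
open import Data.Rational.Properties
import Data.Rational.Unnormalised.Base as ℚᵘ
import Data.Rational.Unnormalised.Properties as ℚᵘ
open import Data.Rational.Solver using (module +-*-Solver)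
open import Data.Sum.Base using (_⊎_; inj₁; inj₂)
open import Data.Vec.Functional as Vector using (removeAt; insertAt; _++_)
open import Data.Vec.Functional.Properties using (insertAt-lookup; insertAt-punchIn; lookup-++ˡ; lookup-++ʳ)
open import Function.Base using (_∘_; id)
open import Level using (0ℓ)
open import Relation.Binary.Definitions using (tri<; tri≈; tri>)
open import Relation.Binary.PropositionalEquality
open import Relation.Nullary using (¬_; Dec; yes; no; does; contradiction; ¬?; decidable-stable; _×-dec_)
open import Relation.Nullary.Decidable using (¬¬-excluded-middle)
open import Relation.Unary using (Pred; Decidable; _∈_)

open +-*-Solver using (solve; _:=_; _:+_; _:*_; _:-_; :-_; con)
open import Algebra.Properties.Semiring.Sum (CommutativeRing.semiring +-*-commutativeRing)
  using (sum; sum-cong-≗; sum-remove; sum-replicate-zero; ∑-comm; *-distribˡ-sum; *-distribʳ-sum)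
open import Algebra.Properties.CommutativeMonoid.Sum *-1-commutativeMonoid using () renaming (sum to product)

-- Rational inequalities and the embedding of the naturals.

0≤1 : 0ℚ ≤ 1ℚ
0≤1 = nonNegative⁻¹ 1ℚ

0≤½ : 0ℚ ≤ ½
0≤½ = nonNegative⁻¹ ½

infixl 6 _+≥0_
infixl 7 _*≥0_

_+≥0_ : ∀ {p q} → 0ℚ ≤ p → 0ℚ ≤ q → 0ℚ ≤ p + q
_+≥0_ = +-mono-≤

_*≥0_ : ∀ {p q} → 0ℚ ≤ p → 0ℚ ≤ q → 0ℚ ≤ p * q
_*≥0_ {p} {q} 0≤p 0≤q =
  nonNegative⁻¹ (p * q) {{nonNeg*nonNeg⇒nonNeg p {{ℚ.nonNegative 0≤p}} q {{ℚ.nonNegative 0≤q}}}}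

-- Many inequalities below are proved by such a certificate: a slack `e` assembled from visibly
-- nonnegative pieces, and an identity `q ≡ p + e` that is mostly left to the ring solver.
≤-cert : ∀ {p q e} → 0ℚ ≤ e → q ≡ p + e → p ≤ q
≤-cert {p} {q} {e} 0≤e q≡p+e = begin
  p       ≡⟨ +-identityʳ p ⟨
  p + 0ℚ  ≤⟨ +-monoʳ-≤ p 0≤e ⟩
  p + e   ≡⟨ q≡p+e ⟨
  q       ∎
  where open ≤-Reasoning

p≤q⇒0≤q-p : ∀ {p q} → p ≤ q → 0ℚ ≤ q - p
p≤q⇒0≤q-p {p} {q} p≤q = subst (_≤ q - p) (+-inverseʳ p) (+-monoˡ-≤ (- p) p≤q)

*-monoʳ-≤ : ∀ {p q r} → 0ℚ ≤ r → p ≤ q → p * r ≤ q * r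
*-monoʳ-≤ {r = r} 0≤r = *-monoʳ-≤-nonNeg r {{ℚ.nonNegative 0≤r}}

*-monoˡ-≤ : ∀ {p q r} → 0ℚ ≤ r → p ≤ q → r * p ≤ r * q
*-monoˡ-≤ {r = r} 0≤r = *-monoˡ-≤-nonNeg r {{ℚ.nonNegative 0≤r}}

toℚᵘ-nat : ∀ m → toℚᵘ (nat m) ℚᵘ.≃ ℚᵘ.mkℚᵘ (ℤ.+ m) 0
toℚᵘ-nat m = toℚᵘ-fromℚᵘ (ℚᵘ.mkℚᵘ (ℤ.+ m) 0)

nat-+ : ∀ m n → nat (m ℕ.+ n) ≡ nat m + nat n
nat-+ m n = toℚᵘ-injective (begin
  toℚᵘ (nat (m ℕ.+ n))                    ≈⟨ toℚᵘ-nat (m ℕ.+ n) ⟩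
  ℚᵘ.mkℚᵘ (ℤ.+ (m ℕ.+ n)) 0               ≈⟨ ℚᵘ.*≡* (cong (ℤ._* ℤ.+ 1) (trans (ℤ.pos-+ m n) (sym (cong₂ ℤ._+_ (ℤ.*-identityʳ (ℤ.+ m)) (ℤ.*-identityʳ (ℤ.+ n)))))) ⟩
  ℚᵘ.mkℚᵘ (ℤ.+ m) 0 ℚᵘ.+ ℚᵘ.mkℚᵘ (ℤ.+ n) 0 ≈⟨ ℚᵘ.+-cong (toℚᵘ-nat m) (toℚᵘ-nat n) ⟨
  toℚᵘ (nat m) ℚᵘ.+ toℚᵘ (nat n)          ≈⟨ toℚᵘ-homo-+ (nat m) (nat n) ⟨
  toℚᵘ (nat m + nat n)                    ∎)
  where open ℚᵘ.≃-Reasoning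

nat-* : ∀ m n → nat (m ℕ.* n) ≡ nat m * nat n
nat-* zero    n = sym (*-zeroˡ (nat n))
nat-* (suc m) n = begin
  nat (n ℕ.+ m ℕ.* n)        ≡⟨ nat-+ n (m ℕ.* n) ⟩
  nat n + nat (m ℕ.* n)      ≡⟨ cong (nat n +_) (nat-* m n) ⟩
  nat n + nat m * nat n      ≡⟨ solve 2 (λ m n → n :+ m :* n := (con 1ℚ :+ m) :* n) refl (nat m) (nat n) ⟩
  (1ℚ + nat m) * nat n       ≡⟨ cong (_* nat n) (nat-+ 1 m) ⟨
  nat (suc m) * nat n        ∎
  where open ≡-Reasoning

0≤nat : ∀ m → 0ℚ ≤ nat m
0≤nat m = nonNegative⁻¹ (nat m) {{normalize-nonNeg m 1}}

nat-mono-≤ : ∀ {m n} → m ℕ.≤ n → nat m ≤ nat n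
nat-mono-≤ {m} {n} m≤n = ≤-cert (0≤nat (n ℕ.∸ m))
  (trans (cong nat (sym (ℕ.m+[n∸m]≡n m≤n))) (nat-+ m (n ℕ.∸ m)))

1/suc : ℕ → ℚ
1/suc j = (ℤ.+ 1) / suc j

1/suc-inverse : ∀ j → 1/suc j * nat (suc j) ≡ 1ℚ
1/suc-inverse j = toℚᵘ-injective (begin
  toℚᵘ (1/suc j * nat (suc j))                     ≈⟨ toℚᵘ-homo-* (1/suc j) (nat (suc j)) ⟩
  toℚᵘ (1/suc j) ℚᵘ.* toℚᵘ (nat (suc j))           ≈⟨ ℚᵘ.*-cong (toℚᵘ-fromℚᵘ (ℚᵘ.mkℚᵘ (ℤ.+ 1) j)) (toℚᵘ-nat (suc j)) ⟩
  ℚᵘ.mkℚᵘ (ℤ.+ 1) j ℚᵘ.* ℚᵘ.mkℚᵘ (ℤ.+ suc j) 0     ≈⟨ ℚᵘ.*-inverseˡ (ℚᵘ.mkℚᵘ (ℤ.+ suc j) 0) ⟩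
  ℚᵘ.1ℚᵘ                                           ∎)
  where open ℚᵘ.≃-Reasoning

0≤1/suc : ∀ j → 0ℚ ≤ 1/suc j
0≤1/suc j = nonNegative⁻¹ (1/suc j) {{normalize-nonNeg 1 (suc j)}}

-- Truncated exponential

expTerm-nonNeg : ∀ {x} → 0ℚ ≤ x → ∀ j → 0ℚ ≤ expTerm x j
expTerm-nonNeg 0≤x zero    = 0≤1
expTerm-nonNeg 0≤x (suc j) = expTerm-nonNeg 0≤x j *≥0 (0≤x *≥0 0≤1/suc j)

expPartial-nonNeg : ∀ {x} → 0ℚ ≤ x → ∀ N → 0ℚ ≤ expPartial x N
expPartial-nonNeg 0≤x zero    = 0≤1
expPartial-nonNeg 0≤x (suc N) = expPartial-nonNeg 0≤x N +≥0 expTerm-nonNeg 0≤x (suc N)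

expPartial-step : ∀ {x} → 0ℚ ≤ x → ∀ N → expPartial x N ≤ expPartial x (suc N)
expPartial-step 0≤x N = ≤-cert (expTerm-nonNeg 0≤x (suc N)) refl

suc*expTerm : ∀ x j → nat (suc j) * expTerm x (suc j) ≡ x * expTerm x j
suc*expTerm x j = begin
  nat (suc j) * (expTerm x j * (x * 1/suc j)) ≡⟨ solve 4 (λ s e x i → s :* (e :* (x :* i)) := (i :* s) :* (x :* e)) refl (nat (suc j)) (expTerm x j) x (1/suc j) ⟩
  (1/suc j * nat (suc j)) * (x * expTerm x j) ≡⟨ cong (_* (x * expTerm x j)) (1/suc-inverse j) ⟩
  1ℚ * (x * expTerm x j)                      ≡⟨ *-identityˡ _ ⟩
  x * expTerm x j                             ∎
  where open ≡-Reasoning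

-- The ring solver treats `1/suc (suc j)` as an atom. Writing a term of the series with this factor
-- in front lets the solver compare it with the next term.
1/suc-step : ∀ j z → z ≡ 1/suc (suc j) * (nat (suc j) * z + z)
1/suc-step j z = begin
  z                                         ≡⟨ *-identityˡ z ⟨
  1ℚ * z                                    ≡⟨ cong (_* z) (1/suc-inverse (suc j)) ⟨
  (i * nat (suc (suc j))) * z               ≡⟨ cong (λ s → i * s * z) (nat-+ 1 (suc j)) ⟩
  (i * (1ℚ + nat (suc j))) * z              ≡⟨ solve 3 (λ i s z → i :* (con 1ℚ :+ s) :* z := i :* (s :* z :+ z)) refl i (nat (suc j)) z ⟩
  i * (nat (suc j) * z + z)                 ∎
  where
  open ≡-Reasoning
  i = 1/suc (suc j)

1/suc-step-expTerm : ∀ x j → expTerm x (suc j) ≡ 1/suc (suc j) * (x * expTerm x j + expTerm x (suc j))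
1/suc-step-expTerm x j = trans (1/suc-step j (expTerm x (suc j)))
  (cong (λ z → 1/suc (suc j) * (z + expTerm x (suc j))) (suc*expTerm x j))

-- Mean value bounds: x^{j+1}/(j+1)! has derivative x^j/j!.
expTerm-upper : ∀ {x h} → 0ℚ ≤ x → 0ℚ ≤ h → ∀ j →
                expTerm (x + h) (suc j) ≤ expTerm x (suc j) + h * expTerm (x + h) j
expTerm-upper {x} {h} 0≤x 0≤h zero = ≤-reflexive
  (solve 2 (λ x h → con 1ℚ :* ((x :+ h) :* con 1ℚ) := con 1ℚ :* (x :* con 1ℚ) :+ h :* con 1ℚ) refl x h)
expTerm-upper {x} {h} 0≤x 0≤h (suc j) = ≤-cert
  (0≤1/suc (suc j) *≥0 (0≤x *≥0 p≤q⇒0≤q-p (expTerm-upper 0≤x 0≤h j) +≥0 0≤h *≥0 0≤h *≥0 expTerm-nonNeg (0≤x +≥0 0≤h) j))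
  (trans (cong (λ z → F′ * (x * i) + h * z) (1/suc-step-expTerm (x + h) j))
    (solve 6 (λ x h i E E′ F′ →
       F′ :* (x :* i) :+ h :* (i :* ((x :+ h) :* E :+ E′))
       := E′ :* ((x :+ h) :* i) :+ i :* (x :* (F′ :+ h :* E :- E′) :+ h :* h :* E))
      refl x h i E E′ F′))
  where
  i = 1/suc (suc j)
  E = expTerm (x + h) j
  E′ = expTerm (x + h) (suc j)
  F′ = expTerm x (suc j)

expTerm-lower : ∀ {x h} → 0ℚ ≤ x → 0ℚ ≤ h → ∀ j →
                expTerm x (suc j) + h * expTerm x j ≤ expTerm (x + h) (suc j)
expTerm-lower {x} {h} 0≤x 0≤h zero = ≤-reflexive
  (solve 2 (λ x h → con 1ℚ :* (x :* con 1ℚ) :+ h :* con 1ℚ := con 1ℚ :* ((x :+ h) :* con 1ℚ)) refl x h)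
expTerm-lower {x} {h} 0≤x 0≤h (suc j) = ≤-cert
  (0≤1/suc (suc j) *≥0 ((0≤x +≥0 0≤h) *≥0 p≤q⇒0≤q-p (expTerm-lower 0≤x 0≤h j) +≥0 0≤h *≥0 0≤h *≥0 expTerm-nonNeg 0≤x j))
  (trans
    (solve 6 (λ x h i F F′ E′ →
       E′ :* ((x :+ h) :* i)
       := F′ :* (x :* i) :+ h :* (i :* (x :* F :+ F′)) :+ i :* ((x :+ h) :* (E′ :- (F′ :+ h :* F)) :+ h :* h :* F))
      refl x h i F F′ E′)
    (cong (λ z → F′ * (x * i) + h * z + i * ((x + h) * (E′ - (F′ + h * F)) + h * h * F))
      (sym (1/suc-step-expTerm x j))))
  where
  i = 1/suc (suc j)
  F = expTerm x j
  F′ = expTerm x (suc j)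
  E′ = expTerm (x + h) (suc j)

-- The termwise bounds are summed. The index drops by one in the last factor because the derivative
-- of the truncation at `suc N` is the truncation at `N`.
expPartial-upper : ∀ {x h} → 0ℚ ≤ x → 0ℚ ≤ h → ∀ N →
                   expPartial (x + h) (suc N) ≤ expPartial x (suc N) + h * expPartial (x + h) N
expPartial-upper {x} {h} 0≤x 0≤h zero = ≤-trans (+-monoʳ-≤ 1ℚ (expTerm-upper 0≤x 0≤h zero))
  (≤-reflexive (sym (+-assoc 1ℚ (expTerm x 1) (h * 1ℚ))))
expPartial-upper {x} {h} 0≤x 0≤h (suc N) = ≤-trans
  (+-mono-≤ (expPartial-upper 0≤x 0≤h N) (expTerm-upper 0≤x 0≤h (suc N)))
  (≤-reflexive (solve 5 (λ h a b c d → (a :+ h :* b) :+ (c :+ h :* d) := (a :+ c) :+ h :* (b :+ d)) refl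
    h (expPartial x (suc N)) (expPartial (x + h) N) (expTerm x (suc (suc N))) (expTerm (x + h) (suc N))))

expPartial-lower : ∀ {x h} → 0ℚ ≤ x → 0ℚ ≤ h → ∀ N →
                   expPartial x (suc N) + h * expPartial x N ≤ expPartial (x + h) (suc N)
expPartial-lower {x} {h} 0≤x 0≤h zero = ≤-trans
  (≤-reflexive (+-assoc 1ℚ (expTerm x 1) (h * 1ℚ)))
  (+-monoʳ-≤ 1ℚ (expTerm-lower 0≤x 0≤h zero))
expPartial-lower {x} {h} 0≤x 0≤h (suc N) = ≤-trans
  (≤-reflexive (solve 5 (λ h a b c d → (a :+ c) :+ h :* (b :+ d) := (a :+ h :* b) :+ (c :+ h :* d)) refl
    h (expPartial x (suc N)) (expPartial x N) (expTerm x (suc (suc N))) (expTerm x (suc N))))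
  (+-mono-≤ (expPartial-lower 0≤x 0≤h N) (expTerm-lower 0≤x 0≤h (suc N)))

expPartial-mono-≤ : ∀ {x y} → 0ℚ ≤ x → x ≤ y → ∀ N → expPartial x N ≤ expPartial y N
expPartial-mono-≤ 0≤x x≤y zero = ≤-refl
expPartial-mono-≤ {x} {y} 0≤x x≤y (suc N) =
  subst (λ z → expPartial x (suc N) ≤ expPartial z (suc N)) (solve 2 (λ x y → x :+ (y :- x) := y) refl x y)
    (≤-trans (≤-cert (0≤y-x *≥0 expPartial-nonNeg 0≤x N) refl) (expPartial-lower 0≤x 0≤y-x N))
  where 0≤y-x = p≤q⇒0≤q-p x≤y

-- From the lower mean value bound, as a truncation of exp x · (1 + h) ≤ exp (x + h). The factor 1 +
-- h raises the degree, so one more term is allowed on the right.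
expPartial-grow : ∀ {x h} → 0ℚ ≤ x → 0ℚ ≤ h → ∀ N →
                  expPartial x N * (1ℚ + h) ≤ expPartial (x + h) (suc N)
expPartial-grow {x} {h} 0≤x 0≤h N = ≤-trans
  (≤-cert (expTerm-nonNeg 0≤x (suc N))
    (solve 3 (λ h a b → (a :+ b) :+ h :* a := a :* (con 1ℚ :+ h) :+ b) refl h (expPartial x N) (expTerm x (suc N))))
  (expPartial-lower 0≤x 0≤h N)

-- From the upper mean value bound exp (x + h) - exp x ≤ h exp (x + h), at one and the same
-- truncation.
expPartial-shrink : ∀ {x h} → 0ℚ ≤ x → 0ℚ ≤ h → ∀ N →
                    expPartial (x + h) N * (1ℚ - h) ≤ expPartial x N
expPartial-shrink {x} {h} 0≤x 0≤h zero = ≤-cert 0≤h (solve 1 (λ h → con 1ℚ := con 1ℚ :* (con 1ℚ :- h) :+ h) refl h)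
expPartial-shrink {x} {h} 0≤x 0≤h (suc N) = ≤-cert
  (p≤q⇒0≤q-p (expPartial-upper 0≤x 0≤h N) +≥0 0≤h *≥0 expTerm-nonNeg (0≤x +≥0 0≤h) (suc N))
  (solve 4 (λ h a b c → a := (b :+ c) :* (con 1ℚ :- h) :+ ((a :+ h :* b :- (b :+ c)) :+ h :* c)) refl
    h (expPartial x (suc N)) (expPartial (x + h) N) (expTerm (x + h) (suc N)))

expPartial-0 : ∀ N → expPartial 0ℚ N ≡ 1ℚ
expPartial-0 zero = refl
expPartial-0 (suc N) = trans
  (solve 3 (λ a b c → a :+ b :* (con 0ℚ :* c) := a) refl (expPartial 0ℚ N) (expTerm 0ℚ N) (1/suc N))
  (expPartial-0 N)

-- A step of ½ from 0 costs a factor 1/(1 - ½) = 2; a second step then gives exp 1 ≤ 4. These values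
-- settle the case r ≤ 1.
expPartial-½-≤-2 : ∀ N → expPartial ½ N ≤ nat 2
expPartial-½-≤-2 N = ≤-trans
  (≤-reflexive (solve 1 (λ a → a := con (nat 2) :* (a :* (con 1ℚ :- con ½))) refl (expPartial ½ N)))
  (*-monoˡ-≤ (0≤nat 2) (≤-trans (expPartial-shrink ≤-refl 0≤½ N) (≤-reflexive (expPartial-0 N))))

expPartial-1-≤-4 : ∀ N → expPartial 1ℚ N ≤ nat 4
expPartial-1-≤-4 N = ≤-trans
  (≤-reflexive (solve 1 (λ a → a := con (nat 2) :* (a :* (con 1ℚ :- con ½))) refl (expPartial 1ℚ N)))
  (*-monoˡ-≤ (0≤nat 2) (≤-trans (expPartial-shrink 0≤½ 0≤½ N) (expPartial-½-≤-2 N)))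

-- Finite sums, the Kronecker delta and reindexing.

sum-mono-≤ : ∀ {n} {f g : Fin n → ℚ} → (∀ i → f i ≤ g i) → sum f ≤ sum g
sum-mono-≤ {zero}  f≤g = ≤-refl
sum-mono-≤ {suc n} f≤g = +-mono-≤ (f≤g zero) (sum-mono-≤ (f≤g ∘ suc))

sum-nonNeg : ∀ {n} {f : Fin n → ℚ} → (∀ i → 0ℚ ≤ f i) → 0ℚ ≤ sum f
sum-nonNeg {zero}  0≤f = ≤-refl
sum-nonNeg {suc n} 0≤f = 0≤f zero +≥0 sum-nonNeg (0≤f ∘ suc)

term≤sum : ∀ {n} {f : Fin n → ℚ} → (∀ i → 0ℚ ≤ f i) → ∀ i → f i ≤ sum f
term≤sum {suc n} {f} 0≤f i = ≤-cert (sum-nonNeg (0≤f ∘ punchIn i)) (sum-remove {i = i} f)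

sum-const : ∀ n x → sum {n} (λ _ → x) ≡ nat n * x
sum-const zero    x = sym (*-zeroˡ x)
sum-const (suc n) x = trans (cong (x +_) (sum-const n x))
  (trans (solve 2 (λ m x → x :+ m :* x := (con 1ℚ :+ m) :* x) refl (nat n) x) (cong (_* x) (sym (nat-+ 1 n))))

sum-*-linearʳ : ∀ {n} (a x z : Fin n → ℚ) θ →
                sum (λ v → a v * (x v + θ * z v)) ≡ sum (λ v → a v * x v) + θ * sum (λ v → a v * z v)
sum-*-linearʳ {zero}  a x z θ = solve 1 (λ θ → con 0ℚ := con 0ℚ :+ θ :* con 0ℚ) refl θ
sum-*-linearʳ {suc n} a x z θ = trans (cong (a zero * (x zero + θ * z zero) +_) (sum-*-linearʳ (a ∘ suc) (x ∘ suc) (z ∘ suc) θ))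
  (solve 6 (λ a x z θ s t → a :* (x :+ θ :* z) :+ (s :+ θ :* t) := (a :* x :+ s) :+ θ :* (a :* z :+ t)) refl
    (a zero) (x zero) (z zero) θ _ _)

sum-*-linearˡ : ∀ {n} (f g z : Fin n → ℚ) θ →
                sum (λ v → (f v + θ * g v) * z v) ≡ sum (λ v → f v * z v) + θ * sum (λ v → g v * z v)
sum-*-linearˡ f g z θ = begin
  sum (λ v → (f v + θ * g v) * z v)                     ≡⟨ sum-cong-≗ (λ v → *-comm _ (z v)) ⟩
  sum (λ v → z v * (f v + θ * g v))                     ≡⟨ sum-*-linearʳ z f g θ ⟩
  sum (λ v → z v * f v) + θ * sum (λ v → z v * g v)     ≡⟨ cong₂ (λ s t → s + θ * t) (sum-cong-≗ (λ v → *-comm (z v) (f v))) (sum-cong-≗ (λ v → *-comm (z v) (g v))) ⟩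
  sum (λ v → f v * z v) + θ * sum (λ v → g v * z v)     ∎
  where open ≡-Reasoning

δ : ∀ {n} → Fin n → Fin n → ℚ
δ zero    zero    = 1ℚ
δ zero    (suc j) = 0ℚ
δ (suc i) zero    = 0ℚ
δ (suc i) (suc j) = δ i j

sum-0* : ∀ {n} (f : Fin n → ℚ) → sum (λ j → 0ℚ * f j) ≡ 0ℚ
sum-0* {n} f = trans (sum-cong-≗ (*-zeroˡ ∘ f)) (sum-replicate-zero n)

sum-δ : ∀ {n} (i : Fin n) (f : Fin n → ℚ) → sum (λ j → δ i j * f j) ≡ f i
sum-δ zero    f = trans (cong₂ _+_ (*-identityˡ (f zero)) (sum-0* (f ∘ suc))) (+-identityʳ (f zero))
sum-δ (suc i) f = trans (cong₂ _+_ (*-zeroˡ (f zero)) (sum-δ i (f ∘ suc))) (+-identityˡ (f (suc i)))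

sum-insertAt : ∀ {n} (F : Fin (suc n) → ℚ → ℚ) (z : Fin n → ℚ) p x →
               sum (λ v → F v (insertAt z p x v)) ≡ F p x + sum (λ j → F (punchIn p j) (z j))
sum-insertAt F z p x = trans (sum-remove {i = p} (λ v → F v (insertAt z p x v)))
  (cong₂ _+_ (cong (F p) (insertAt-lookup z p x)) (sum-cong-≗ (λ j → cong (F (punchIn p j)) (insertAt-punchIn z p x j))))

insertAt-elim : ∀ {n} (P : ℚ → Set) {z : Fin n → ℚ} p {x} → P x → (∀ j → P (z j)) → ∀ v → P (insertAt z p x v)
insertAt-elim         P zero    Px Pz zero    = Px
insertAt-elim         P zero    Px Pz (suc v) = Pz v
insertAt-elim {suc n} P (suc p) Px Pz zero    = Pz zero
insertAt-elim {suc n} P (suc p) Px Pz (suc v) = insertAt-elim P p Px (Pz ∘ suc) v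

sum-++ : ∀ m {n} (f : Fin (m ℕ.+ n) → ℚ) → sum f ≡ sum (f ∘ (_↑ˡ n)) + sum (f ∘ (m ↑ʳ_))
sum-++ zero    f = sym (+-identityˡ _)
sum-++ (suc m) f = trans (cong (f zero +_) (sum-++ m (f ∘ suc))) (sym (+-assoc (f zero) _ _))

sum-combine : ∀ m {n} (f : Fin (m ℕ.* n) → ℚ) → sum f ≡ sum (λ i → sum (λ j → f (combine {m} {n} i j)))
sum-combine zero        f = refl
sum-combine (suc m) {n} f = trans (sum-++ n f) (cong (sum (f ∘ (_↑ˡ m ℕ.* n)) +_) (sum-combine m (f ∘ (n ↑ʳ_))))

-- Linear algebra

-- Gaussian elimination on the first row: if it vanishes it is dropped; otherwise a pivot column `p`
-- is eliminated from the other rows, and the numbers of equations and unknowns both fall by one.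
dependence : ∀ {E V} → E ℕ.< V → (A : Fin E → Fin V → ℚ) →
             ∃ λ (z : Fin V → ℚ) → (∃ λ p → z p ≢ 0ℚ) × (∀ e → sum (λ v → A e v * z v) ≡ 0ℚ)
dependence {zero}  {suc V} E<V A = (λ _ → 1ℚ) , (zero , 1≢0) , λ ()
dependence {suc E} {suc V} (ℕ.s≤s E<V) A with Fin.any? (λ v → ¬? (A zero v ≟ 0ℚ))
... | no all-zero with dependence (ℕ.m<n⇒m<1+n E<V) (A ∘ suc)
...   | z , z≢0 , Az≡0 = z , z≢0 , λ
  { zero    → trans (sum-cong-≗ (λ v → cong (_* z v) (decidable-stable (A zero v ≟ 0ℚ) (λ A≢0 → all-zero (v , A≢0))))) (sum-0* z)
  ; (suc e) → Az≡0 e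
  }
dependence {suc E} {suc V} (ℕ.s≤s E<V) A | yes (p , A₀ₚ≢0)
  with dependence E<V (λ e j → A (suc e) (punchIn p j) + (- (A (suc e) p * (1/ A zero p) {{ℚ.≢-nonZero A₀ₚ≢0}})) * A zero (punchIn p j))
... | z′ , (q , z′q≢0) , Bz′≡0 = z , (punchIn p q , zq≢0) , Az≡0
  where
  open ≡-Reasoning
  c = (1/ A zero p) {{ℚ.≢-nonZero A₀ₚ≢0}}
  σ = sum (λ j → A zero (punchIn p j) * z′ j)
  -- Back substitution: the pivot coordinate takes the one value that makes the first row vanish.
  z = insertAt z′ p (- (c * σ))

  zq≢0 : z (punchIn p q) ≢ 0ℚ
  zq≢0 = z′q≢0 ∘ trans (sym (insertAt-punchIn z′ p _ q))

  Az≡0 : ∀ e → sum (λ v → A e v * z v) ≡ 0ℚ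
  Az≡0 zero = begin
    sum (λ v → A zero v * z v)          ≡⟨ sum-insertAt (λ v x → A zero v * x) z′ p _ ⟩
    A zero p * (- (c * σ)) + σ          ≡⟨ solve 3 (λ a c s → a :* (:- (c :* s)) :+ s := s :- (a :* c) :* s) refl (A zero p) c σ ⟩
    σ - (A zero p * c) * σ              ≡⟨ cong (λ t → σ - t * σ) (*-inverseʳ (A zero p) {{ℚ.≢-nonZero A₀ₚ≢0}}) ⟩
    σ - 1ℚ * σ                          ≡⟨ solve 1 (λ s → s :- con 1ℚ :* s := con 0ℚ) refl σ ⟩
    0ℚ                                  ∎
  Az≡0 (suc e) = begin
    sum (λ v → A (suc e) v * z v)       ≡⟨ sum-insertAt (λ v x → A (suc e) v * x) z′ p _ ⟩
    a * (- (c * σ)) + τ                 ≡⟨ solve 4 (λ a c s t → a :* (:- (c :* s)) :+ t := t :+ (:- (a :* c)) :* s) refl a c σ τ ⟩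
    τ + (- (a * c)) * σ                 ≡⟨ sum-*-linearˡ (λ j → A (suc e) (punchIn p j)) (λ j → A zero (punchIn p j)) z′ (- (a * c)) ⟨
    sum (λ j → (A (suc e) (punchIn p j) + (- (a * c)) * A zero (punchIn p j)) * z′ j) ≡⟨ Bz′≡0 e ⟩
    0ℚ                                  ∎
    where
    a = A (suc e) p
    τ = sum (λ j → A (suc e) (punchIn p j) * z′ j)

inverse-of-neg : ∀ {z} → z < 0ℚ → ∃ λ c → 0ℚ ≤ c × c * z ≡ - 1ℚ
inverse-of-neg {z} z<0 = - c , <⇒≤ (neg-antimono-< (negative⁻¹ c {{1/neg⇒neg z {{ℚ.negative z<0}}}})) ,
  trans (sym (neg-distribˡ-* c z)) (cong -_ (*-inverseˡ z {{ℚ.<-nonZero z<0}}))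
  where c = (1/ z) {{ℚ.<-nonZero z<0}}

-- The ratio test of the simplex method, one coordinate at a time: the step length found so far is
-- kept if the new coordinate stays nonnegative, and is otherwise shortened to the zero of that
-- coordinate.
ray-to-boundary : ∀ {n} (x z : Fin n → ℚ) → (∀ v → 0ℚ ≤ x v) →
       (∀ v → 0ℚ ≤ z v) ⊎ (∃ λ θ → 0ℚ ≤ θ × (∀ v → 0ℚ ≤ x v + θ * z v) × (∃ λ p → x p + θ * z p ≡ 0ℚ))
ray-to-boundary {zero}  x z 0≤x = inj₁ λ ()
ray-to-boundary {suc n} x z 0≤x with ray-to-boundary (x ∘ suc) (z ∘ suc) (0≤x ∘ suc)
ray-to-boundary {suc n} x z 0≤x | inj₁ 0≤z with 0ℚ ≤? z zero
... | yes 0≤z₀ = inj₁ λ { zero → 0≤z₀ ; (suc v) → 0≤z v }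
... | no  0≰z₀ with inverse-of-neg (≰⇒> 0≰z₀)
...   | c , 0≤c , cz≡-1 = inj₂ (x zero * c , 0≤θ ,
        (λ { zero → ≤-reflexive (sym eq) ; (suc v) → 0≤x (suc v) +≥0 0≤θ *≥0 0≤z v }) , zero , eq)
  where
  0≤θ = 0≤x zero *≥0 0≤c
  eq : x zero + x zero * c * z zero ≡ 0ℚ
  eq = trans (cong (x zero +_) (trans (*-assoc (x zero) c (z zero)) (cong (x zero *_) cz≡-1)))
    (solve 1 (λ x → x :+ x :* (:- con 1ℚ) := con 0ℚ) refl (x zero))
ray-to-boundary {suc n} x z 0≤x | inj₂ (θ′ , 0≤θ′ , in-orthant , p , eq′) with 0ℚ ≤? x zero + θ′ * z zero
... | yes ok = inj₂ (θ′ , 0≤θ′ , (λ { zero → ok ; (suc v) → in-orthant v }) , suc p , eq′)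
... | no ¬ok with 0ℚ ≤? z zero
...   | yes 0≤z₀ = contradiction (0≤x zero +≥0 0≤θ′ *≥0 0≤z₀) ¬ok
...   | no  0≰z₀ with inverse-of-neg (≰⇒> 0≰z₀)
...     | c , 0≤c , cz≡-1 = inj₂ (θ , 0≤θ , (λ { zero → ≤-reflexive (sym eq) ; (suc v) → shorter v }) , zero , eq)
  where
  -- Here c = -1/z₀, so θ = -x₀/z₀. It is at most `θ′` because the new coordinate is already
  -- negative at `θ′`.
  θ = x zero * c
  0≤θ = 0≤x zero *≥0 0≤c
  eq : x zero + θ * z zero ≡ 0ℚ
  eq = trans (cong (x zero +_) (trans (*-assoc (x zero) c (z zero)) (cong (x zero *_) cz≡-1)))
    (solve 1 (λ x → x :+ x :* (:- con 1ℚ) := con 0ℚ) refl (x zero))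
  θ≤θ′ : θ ≤ θ′
  θ≤θ′ = ≤-cert (0≤c *≥0 p≤q⇒0≤q-p (<⇒≤ (≰⇒> ¬ok)))
    (trans (solve 4 (λ x θ′ c z → θ′ := x :* c :+ c :* (con 0ℚ :- (x :+ θ′ :* z)) :+ θ′ :* (con 1ℚ :+ c :* z)) refl (x zero) θ′ c (z zero))
    (trans (cong (λ t → x zero * c + c * (0ℚ - (x zero + θ′ * z zero)) + θ′ * (1ℚ + t)) cz≡-1)
      (solve 2 (λ a θ′ → a :+ θ′ :* (con 1ℚ :+ (:- con 1ℚ)) := a) refl _ θ′)))
  shorter : ∀ v → 0ℚ ≤ x (suc v) + θ * z (suc v)
  shorter v with 0ℚ ≤? z (suc v)
  ... | yes 0≤zᵥ = 0≤x (suc v) +≥0 0≤θ *≥0 0≤zᵥ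
  ... | no  0≰zᵥ = ≤-cert (in-orthant v +≥0 p≤q⇒0≤q-p θ≤θ′ *≥0 p≤q⇒0≤q-p (<⇒≤ (≰⇒> 0≰zᵥ)))
    (solve 4 (λ x θ θ′ z → x :+ θ :* z := con 0ℚ :+ ((x :+ θ′ :* z) :+ (θ′ :- θ) :* (con 0ℚ :- z))) refl (x (suc v)) θ θ′ (z (suc v)))

-- A nonzero direction or its opposite has a negative entry, so at least one of the two rays leaves
-- the orthant.
line-to-boundary : ∀ {n} (x z : Fin n → ℚ) → (∀ v → 0ℚ ≤ x v) → (∃ λ p → z p ≢ 0ℚ) →
                  ∃ λ θ → (∀ v → 0ℚ ≤ x v + θ * z v) × (∃ λ p → x p + θ * z p ≡ 0ℚ)
line-to-boundary x z 0≤x (p , zₚ≢0) with ray-to-boundary x z 0≤x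
... | inj₂ (θ , _ , rest) = θ , rest
... | inj₁ 0≤z with ray-to-boundary x (-_ ∘ z) 0≤x
...   | inj₁ 0≤-z = contradiction (≤-antisym (subst (_≤ 0ℚ) (solve 1 (λ z → :- (:- z) := z) refl (z p)) (neg-antimono-≤ (0≤-z p))) (0≤z p)) zₚ≢0
...   | inj₂ (θ , _ , in-orthant , q , eq) =
  - θ , (λ v → subst (0ℚ ≤_) (flip-sign v) (in-orthant v)) , q , trans (sym (flip-sign q)) eq
  where
  flip-sign : ∀ v → x v + θ * (- z v) ≡ x v + (- θ) * z v
  flip-sign v = solve 3 (λ x θ z → x :+ θ :* (:- z) := x :+ (:- θ) :* z) refl (x v) θ (z v)

-- Indicator of being nonzero, so that `sum (sg ∘ x)` is the size of the support of `x`.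
sg : ℚ → ℚ
sg x = if does (x ≟ 0ℚ) then 0ℚ else 1ℚ

sg≤1 : ∀ x → sg x ≤ 1ℚ
sg≤1 x with x ≟ 0ℚ
... | yes _ = 0≤1
... | no  _ = ≤-refl

sum-sg≤ : ∀ {n} (x : Fin n → ℚ) → sum (sg ∘ x) ≤ nat n
sum-sg≤ {n} x = ≤-trans (sum-mono-≤ (sg≤1 ∘ x)) (≤-reflexive (trans (sum-const n 1ℚ) (*-identityʳ (nat n))))

-- While there are more variables than equations, moving along a kernel vector brings some
-- coordinate to 0 and leaves every equation intact; that coordinate is deleted and the argument
-- repeated.
basicSolution : ∀ {E} V (A : Fin E → Fin V → ℚ) (x : Fin V → ℚ) → (∀ v → 0ℚ ≤ x v) →
                ∃ λ (y : Fin V → ℚ) → (∀ v → 0ℚ ≤ y v) × (∀ e → sum (λ v → A e v * y v) ≡ sum (λ v → A e v * x v)) × sum (sg ∘ y) ≤ nat E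
basicSolution {E} zero    A x 0≤x = x , 0≤x , (λ _ → refl) , 0≤nat E
basicSolution {E} (suc V) A x 0≤x with E ℕ.<? suc V
... | no E≮V = x , 0≤x , (λ _ → refl) , ≤-trans (sum-sg≤ x) (nat-mono-≤ (ℕ.≮⇒≥ E≮V))
... | yes E<V with dependence E<V A
...   | z , z≢0 , Az≡0 with line-to-boundary x z 0≤x z≢0
...     | θ , 0≤x′ , p , x′ₚ≡0 with basicSolution V (λ e → removeAt (A e) p) (removeAt (λ v → x v + θ * z v) p) (0≤x′ ∘ punchIn p)
...       | y , 0≤y , Ay≡Ax′ , sg≤E = insertAt y p 0ℚ , insertAt-elim (0ℚ ≤_) p ≤-refl 0≤y , eq ,
              ≤-trans (≤-reflexive (trans (sum-insertAt (λ _ → sg) y p 0ℚ) (+-identityˡ _))) sg≤E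
  where
  open ≡-Reasoning
  eq : ∀ e → sum (λ v → A e v * insertAt y p 0ℚ v) ≡ sum (λ v → A e v * x v)
  eq e = begin
    sum (λ v → A e v * insertAt y p 0ℚ v)                               ≡⟨ sum-insertAt (λ v t → A e v * t) y p 0ℚ ⟩
    A e p * 0ℚ + sum (λ j → A e (punchIn p j) * y j)                    ≡⟨ cong₂ (λ s t → A e p * s + t) (sym x′ₚ≡0) (Ay≡Ax′ e) ⟩
    A e p * (x p + θ * z p) + sum (λ j → A e (punchIn p j) * (x (punchIn p j) + θ * z (punchIn p j)))
                                                                        ≡⟨ sum-remove {i = p} (λ v → A e v * (x v + θ * z v)) ⟨
    sum (λ v → A e v * (x v + θ * z v))                                 ≡⟨ sum-*-linearʳ (A e) x z θ ⟩
    sum (λ v → A e v * x v) + θ * sum (λ v → A e v * z v)               ≡⟨ cong (λ t → sum (λ v → A e v * x v) + θ * t) (Az≡0 e) ⟩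
    sum (λ v → A e v * x v) + θ * 0ℚ                                    ≡⟨ solve 2 (λ s θ → s :+ θ :* con 0ℚ := s) refl _ θ ⟩
    sum (λ v → A e v * x v)                                             ∎

-- The linear system has M equations for the row sums and m for the functionals `c t`, whence the
-- bound on the support. When the rows sum to 1, each needs one positive weight, so at most m
-- weights are in excess.
sparsify : ∀ {M k m} (c : Fin m → Fin M → Fin k → ℚ) (w : Fin M → Fin k → ℚ) → (∀ i s → 0ℚ ≤ w i s) →
           ∃ λ (w′ : Fin M → Fin k → ℚ) → (∀ i s → 0ℚ ≤ w′ i s) × (∀ i → sum (w′ i) ≡ sum (w i)) ×
             (∀ t → sum (λ i → sum (λ s → c t i s * w′ i s)) ≡ sum (λ i → sum (λ s → c t i s * w i s))) ×
             sum (λ i → sum (λ s → sg (w′ i s))) ≤ nat (M ℕ.+ m)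
sparsify {M} {k} {m} c w 0≤w with basicSolution (M ℕ.* k) A (uncurry w ∘ remQuot k) (λ v → uncurry 0≤w (remQuot k v))
  where
  A : Fin (M ℕ.+ m) → Fin (M ℕ.* k) → ℚ
  A = (λ i v → δ i (proj₁ (remQuot {M} k v))) ++ (λ t v → uncurry (c t) (remQuot {M} k v))
... | y , 0≤y , Ay≡Ax , sg≤ = w′ , (λ i s → 0≤y (combine i s)) , rows , costs ,
        ≤-trans (≤-reflexive (sym (sum-combine M (sg ∘ y)))) sg≤
  where
  open ≡-Reasoning
  w′ : Fin M → Fin k → ℚ
  w′ i s = y (combine i s)

  flatten : ∀ (a : Fin M × Fin k → ℚ) (u : Fin (M ℕ.* k) → ℚ) →
            sum (λ v → a (remQuot {M} k v) * u v) ≡ sum (λ i → sum (λ s → a (i , s) * u (combine i s)))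
  flatten a u = trans (sum-combine M (λ v → a (remQuot {M} k v) * u v))
    (sum-cong-≗ (λ i → sum-cong-≗ (λ s → cong (λ is → a is * u (combine i s)) (Fin.remQuot-combine i s))))

  unflatten : ∀ (a : Fin M × Fin k → ℚ) → sum (λ v → a (remQuot {M} k v) * uncurry w (remQuot {M} k v)) ≡ sum (λ i → sum (λ s → a (i , s) * w i s))
  unflatten a = trans (flatten a (uncurry w ∘ remQuot {M} k))
    (sum-cong-≗ (λ i → sum-cong-≗ (λ s → cong (λ is → a (i , s) * uncurry w is) (Fin.remQuot-combine i s))))

  A₁ : Fin M → Fin (M ℕ.* k) → ℚ
  A₁ i v = δ i (proj₁ (remQuot {M} k v))
  A₂ : Fin m → Fin (M ℕ.* k) → ℚ
  A₂ t v = uncurry (c t) (remQuot {M} k v)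

  row-sum : ∀ i (u : Fin M → Fin k → ℚ) → sum (λ j → sum (λ s → δ i j * u j s)) ≡ sum (u i)
  row-sum i u = trans (sum-cong-≗ (λ j → sym (*-distribˡ-sum (δ i j) (u j)))) (sum-δ i (λ j → sum (u j)))

  rows : ∀ i → sum (w′ i) ≡ sum (w i)
  rows i = begin
    sum (w′ i)                                        ≡⟨ row-sum i w′ ⟨
    sum (λ j → sum (λ s → δ i j * w′ j s))            ≡⟨ flatten (λ is → δ i (proj₁ is)) y ⟨
    sum (λ v → A₁ i v * y v)                          ≡⟨ cong (λ row → sum (λ v → row v * y v)) (lookup-++ˡ A₁ A₂ i) ⟨
    sum (λ v → (A₁ ++ A₂) (i ↑ˡ m) v * y v)           ≡⟨ Ay≡Ax (i ↑ˡ m) ⟩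
    sum (λ v → (A₁ ++ A₂) (i ↑ˡ m) v * uncurry w (remQuot {M} k v)) ≡⟨ cong (λ row → sum (λ v → row v * uncurry w (remQuot {M} k v))) (lookup-++ˡ A₁ A₂ i) ⟩
    sum (λ v → A₁ i v * uncurry w (remQuot {M} k v))  ≡⟨ unflatten (λ is → δ i (proj₁ is)) ⟩
    sum (λ j → sum (λ s → δ i j * w j s))             ≡⟨ row-sum i w ⟩
    sum (w i)                                         ∎

  costs : ∀ t → sum (λ i → sum (λ s → c t i s * w′ i s)) ≡ sum (λ i → sum (λ s → c t i s * w i s))
  costs t = begin
    sum (λ i → sum (λ s → c t i s * w′ i s))          ≡⟨ flatten (uncurry (c t)) y ⟨
    sum (λ v → A₂ t v * y v)                          ≡⟨ cong (λ row → sum (λ v → row v * y v)) (lookup-++ʳ A₁ A₂ t) ⟨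
    sum (λ v → (A₁ ++ A₂) (M ↑ʳ t) v * y v)           ≡⟨ Ay≡Ax (M ↑ʳ t) ⟩
    sum (λ v → (A₁ ++ A₂) (M ↑ʳ t) v * uncurry w (remQuot {M} k v)) ≡⟨ cong (λ row → sum (λ v → row v * uncurry w (remQuot {M} k v))) (lookup-++ʳ A₁ A₂ t) ⟩
    sum (λ v → A₂ t v * uncurry w (remQuot {M} k v))  ≡⟨ unflatten (uncurry (c t)) ⟩
    sum (λ i → sum (λ s → c t i s * w i s))           ∎

-- Products against the truncated exponential.

product-nonNeg : ∀ {n} {f : Fin n → ℚ} → (∀ i → 0ℚ ≤ f i) → 0ℚ ≤ product f
product-nonNeg {zero}  0≤f = 0≤1
product-nonNeg {suc n} 0≤f = 0≤f zero *≥0 product-nonNeg (0≤f ∘ suc)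

1≤product*product : ∀ {n} {f g : Fin n → ℚ} → (∀ i → 1ℚ ≤ f i * g i) → 1ℚ ≤ product f * product g
1≤product*product {zero}          1≤fg = ≤-refl
1≤product*product {suc n} {f} {g} 1≤fg = ≤-cert
  (p≤q⇒0≤q-p 1≤P *≥0 (0≤1 +≥0 p≤q⇒0≤q-p (1≤fg zero)) +≥0 p≤q⇒0≤q-p (1≤fg zero))
  (solve 4 (λ a b p q → (a :* p) :* (b :* q)
      := con 1ℚ :+ ((p :* q :- con 1ℚ) :* (con 1ℚ :+ (a :* b :- con 1ℚ)) :+ (a :* b :- con 1ℚ)))
    refl (f zero) (g zero) (product (f ∘ suc)) (product (g ∘ suc)))
  where
  1≤P : 1ℚ ≤ product (f ∘ suc) * product (g ∘ suc)
  1≤P = 1≤product*product (1≤fg ∘ suc)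

-- In the induction negative hᵢ move x up and positive hᵢ move z up, so that both arguments stay nonnegative.
expPartial-*-product : ∀ {m} (h : Fin m → ℚ) N {x z} → (∀ i → h i ≤ 1ℚ) → 0ℚ ≤ x → 0ℚ ≤ z → x ≤ z + sum h →
                       expPartial x N * product (λ i → 1ℚ - h i) ≤ expPartial z (m ℕ.+ N)
expPartial-*-product {zero} h N {x} {z} h≤1 0≤x 0≤z x≤z+Σh =
  ≤-trans (≤-reflexive (*-identityʳ _)) (expPartial-mono-≤ 0≤x (≤-trans x≤z+Σh (≤-reflexive (+-identityʳ z))) N)
expPartial-*-product {suc m} h N {x} {z} h≤1 0≤x 0≤z x≤z+Σh with ≤-total 0ℚ (h zero)
... | inj₁ 0≤h₀ = begin
  expPartial x N * ((1ℚ - h zero) * P)            ≡⟨ solve 3 (λ t a p → t :* (a :* p) := (t :* p) :* a) refl (expPartial x N) (1ℚ - h zero) P ⟩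
  (expPartial x N * P) * (1ℚ - h zero)            ≤⟨ *-monoʳ-≤ (p≤q⇒0≤q-p (h≤1 zero)) (expPartial-*-product (h ∘ suc) N (h≤1 ∘ suc) 0≤x (0≤z +≥0 0≤h₀) (≤-trans x≤z+Σh (≤-reflexive (sym (+-assoc z (h zero) _))))) ⟩
  expPartial (z + h zero) (m ℕ.+ N) * (1ℚ - h zero) ≤⟨ expPartial-shrink 0≤z 0≤h₀ (m ℕ.+ N) ⟩
  expPartial z (m ℕ.+ N)                          ≤⟨ expPartial-step 0≤z (m ℕ.+ N) ⟩
  expPartial z (suc m ℕ.+ N)                      ∎
  where
  open ≤-Reasoning
  P = product (λ i → 1ℚ - h (suc i))
... | inj₂ h₀≤0 = begin
  expPartial x N * ((1ℚ - h zero) * P)            ≡⟨ *-assoc (expPartial x N) (1ℚ - h zero) P ⟨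
  (expPartial x N * (1ℚ - h zero)) * P            ≤⟨ *-monoʳ-≤ (product-nonNeg (λ i → p≤q⇒0≤q-p (h≤1 (suc i)))) (expPartial-grow 0≤x 0≤-h₀ N) ⟩
  expPartial (x - h zero) (suc N) * P             ≤⟨ expPartial-*-product (h ∘ suc) (suc N) (h≤1 ∘ suc) (0≤x +≥0 0≤-h₀) 0≤z
                                                       (≤-trans (+-monoˡ-≤ (- h zero) x≤z+Σh) (≤-reflexive (solve 3 (λ z h s → (z :+ (h :+ s)) :- h := z :+ s) refl z (h zero) (sum (h ∘ suc))))) ⟩
  expPartial z (m ℕ.+ suc N)                      ≡⟨ cong (expPartial z) (ℕ.+-suc m N) ⟩
  expPartial z (suc m ℕ.+ N)                      ∎
  where
  open ≤-Reasoning
  P = product (λ i → 1ℚ - h (suc i))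
  0≤-h₀ : 0ℚ ≤ - h zero
  0≤-h₀ = neg-antimono-≤ h₀≤0

-- Since exp h ≤ 1/(1 - h) for h < 1, the condition 1 ≤ f(1 - h) is a rational way to ensure exp h ≤
-- f for each factor. `expPartial-*-product` is applied at z = 0, where the truncated exponential is
-- 1.
expPartial≤product : ∀ {m} (h f : Fin m → ℚ) → (∀ i → h i ≤ 1ℚ) → (∀ i → 0ℚ ≤ f i) → (∀ i → 1ℚ ≤ f i * (1ℚ - h i)) →
                     ∀ {x} → 0ℚ ≤ x → x ≤ sum h → ∀ N → expPartial x N ≤ product f
expPartial≤product {m} h f h≤1 0≤f 1≤f[1-h] {x} 0≤x x≤Σh N = begin
  T                   ≡⟨ *-identityʳ T ⟨
  T * 1ℚ              ≤⟨ *-monoˡ-≤ (expPartial-nonNeg 0≤x N) (1≤product*product 1≤f[1-h]) ⟩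
  T * (F * P)         ≡⟨ solve 3 (λ t f p → t :* (f :* p) := (t :* p) :* f) refl T F P ⟩
  (T * P) * F         ≤⟨ *-monoʳ-≤ (product-nonNeg 0≤f) (expPartial-*-product h N h≤1 0≤x ≤-refl (≤-trans x≤Σh (≤-reflexive (sym (+-identityˡ _))))) ⟩
  expPartial 0ℚ (m ℕ.+ N) * F ≡⟨ cong (_* F) (expPartial-0 (m ℕ.+ N)) ⟩
  1ℚ * F              ≡⟨ *-identityˡ F ⟩
  F                   ∎
  where
  open ≤-Reasoning
  T = expPartial x N
  F = product f
  P = product (λ i → 1ℚ - h i)

-- Derandomised rounding

nonNeg∧≢0⇒0< : ∀ {w} → 0ℚ ≤ w → w ≢ 0ℚ → 0ℚ < w
nonNeg∧≢0⇒0< 0≤w w≢0 = ≰⇒> (λ w≤0 → w≢0 (≤-antisym w≤0 0≤w))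

-- An averaging argument. The chosen index must carry weight because the later bound on squared
-- deviations holds only on the support.
weighted-choice : ∀ {k} (w g : Fin k → ℚ) B → (∀ s → 0ℚ ≤ w s) → sum w ≡ 1ℚ → sum (λ s → w s * g s) ≤ B →
                  ∃ λ s → w s ≢ 0ℚ × g s ≤ B
weighted-choice {k} w g B 0≤w Σw≡1 Σwg≤B with Fin.any? (λ s → ¬? (w s ≟ 0ℚ) ×-dec (g s ≤? B))
... | yes found = found
... | no  none  = contradiction (trans (sym Σw≡1) (trans (sum-cong-≗ w≡0) (sum-replicate-zero k))) 1≢0
  where
  term : Fin k → ℚ
  -- These terms sum to at most 0. If no index were suitable, each would be nonnegative, and
  -- positive wherever the weight is, so all weights would vanish although they sum to 1.
  term s = w s * (g s + (- B) * 1ℚ)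

  Σterm≤0 : sum term ≤ 0ℚ
  Σterm≤0 = begin
    sum term                                              ≡⟨ sum-*-linearʳ w g (λ _ → 1ℚ) (- B) ⟩
    sum (λ s → w s * g s) + (- B) * sum (λ s → w s * 1ℚ)  ≡⟨ cong (λ t → sum (λ s → w s * g s) + (- B) * t) (trans (sum-cong-≗ (λ s → *-identityʳ (w s))) Σw≡1) ⟩
    sum (λ s → w s * g s) + (- B) * 1ℚ                    ≤⟨ +-monoˡ-≤ ((- B) * 1ℚ) Σwg≤B ⟩
    B + (- B) * 1ℚ                                        ≡⟨ solve 1 (λ b → b :+ (:- b) :* con 1ℚ := con 0ℚ) refl B ⟩
    0ℚ                                                    ∎
    where open ≤-Reasoning

  B<g : ∀ s → w s ≢ 0ℚ → 0ℚ < g s + (- B) * 1ℚ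
  B<g s wₛ≢0 = begin-strict
    0ℚ               ≡⟨ +-inverseʳ B ⟨
    B - B            <⟨ +-monoˡ-< (- B) (≰⇒> (λ g≤B → none (s , wₛ≢0 , g≤B))) ⟩
    g s - B          ≡⟨ cong (g s +_) (*-identityʳ (- B)) ⟨
    g s + (- B) * 1ℚ ∎
    where open ≤-Reasoning

  0≤term : ∀ s → 0ℚ ≤ term s
  0≤term s with w s ≟ 0ℚ
  ... | yes w≡0 = ≤-reflexive (sym (trans (cong (_* _) w≡0) (*-zeroˡ (g s + (- B) * 1ℚ))))
  ... | no  w≢0 = 0≤w s *≥0 <⇒≤ (B<g s w≢0)

  w≡0 : ∀ s → w s ≡ 0ℚ
  w≡0 s = decidable-stable (w s ≟ 0ℚ) λ w≢0 → <-irrefl refl (begin-strict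
    0ℚ       <⟨ positive⁻¹ (term s) {{pos*pos⇒pos (w s) {{ℚ.positive (nonNeg∧≢0⇒0< (0≤w s) w≢0)}} (g s + (- B) * 1ℚ) {{ℚ.positive (B<g s w≢0)}}}} ⟩
    term s   ≤⟨ term≤sum 0≤term s ⟩
    sum term ≤⟨ Σterm≤0 ⟩
    0ℚ       ∎)
    where open ≤-Reasoning

-- One step of conditional expectation: a choice of `s` according to `w` multiplies each `U t` by a
-- factor of mean 1, so the total is preserved on average.
weighted-mean : ∀ {k m} (w : Fin k → ℚ) (G : Fin k → Fin m → ℚ) (U : Fin m → ℚ) →
                (∀ t → sum (λ s → w s * G s t) ≡ 1ℚ) → sum (λ s → w s * sum (λ t → U t * G s t)) ≡ sum U
weighted-mean w G U mean≡1 = begin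
  sum (λ s → w s * sum (λ t → U t * G s t))     ≡⟨ sum-cong-≗ (λ s → *-distribˡ-sum (w s) (λ t → U t * G s t)) ⟩
  sum (λ s → sum (λ t → w s * (U t * G s t)))   ≡⟨ ∑-comm (λ s t → w s * (U t * G s t)) ⟩
  sum (λ t → sum (λ s → w s * (U t * G s t)))   ≡⟨ sum-cong-≗ (λ t → sum-cong-≗ (λ s → swap (w s) (U t) (G s t))) ⟩
  sum (λ t → sum (λ s → U t * (w s * G s t)))   ≡⟨ sum-cong-≗ (λ t → *-distribˡ-sum (U t) (λ s → w s * G s t)) ⟨
  sum (λ t → U t * sum (λ s → w s * G s t))     ≡⟨ sum-cong-≗ (λ t → trans (cong (U t *_) (mean≡1 t)) (*-identityʳ (U t))) ⟩
  sum U                                         ∎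
  where
  open ≡-Reasoning
  swap : ∀ w u g → w * (u * g) ≡ u * (w * g)
  swap = solve 3 (λ w u g → w :* (u :* g) := u :* (w :* g)) refl

-- Method of conditional expectations.
round : ∀ M {k m} (w : Fin M → Fin k → ℚ) (G : Fin M → Fin k → Fin m → ℚ) (U : Fin m → ℚ) →
        (∀ i s → 0ℚ ≤ w i s) → (∀ i → sum (w i) ≡ 1ℚ) → (∀ i t → sum (λ s → w i s * G i s t) ≡ 1ℚ) →
        ∃ λ (φ : Fin M → Fin k) → (∀ i → w i (φ i) ≢ 0ℚ) × sum (λ t → U t * product (λ i → G i (φ i) t)) ≤ sum U
round zero    w G U 0≤w Σw≡1 mean≡1 = (λ ()) , (λ ()) , ≤-reflexive (sum-cong-≗ (λ t → *-identityʳ (U t)))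
round (suc M) {k} w G U 0≤w Σw≡1 mean≡1 = (s Vector.∷ φ) , (λ { zero → proj₁ (proj₂ first) ; (suc i) → proj₁ (proj₂ rest) i }) , bound
  where
  open ≤-Reasoning
  first : ∃ λ s → w zero s ≢ 0ℚ × sum (λ t → U t * G zero s t) ≤ sum U
  first = weighted-choice (w zero) (λ s → sum (λ t → U t * G zero s t)) (sum U) (0≤w zero) (Σw≡1 zero)
            (≤-reflexive (weighted-mean (w zero) (G zero) U (mean≡1 zero)))
  s : Fin k
  s = proj₁ first
  rest : ∃ λ (φ : Fin M → Fin k) → (∀ i → w (suc i) (φ i) ≢ 0ℚ) ×
           sum (λ t → (U t * G zero s t) * product (λ i → G (suc i) (φ i) t)) ≤ sum (λ t → U t * G zero s t)
  -- The factors chosen so far are absorbed into the weights; this is why `U` is arbitrary in the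
  -- statement.
  rest = round M (w ∘ suc) (G ∘ suc) (λ t → U t * G zero s t) (0≤w ∘ suc) (Σw≡1 ∘ suc) (mean≡1 ∘ suc)
  φ : Fin M → Fin k
  φ = proj₁ rest
  bound : sum (λ t → U t * (G zero s t * product (λ i → G (suc i) (φ i) t))) ≤ sum U
  bound = begin
    sum (λ t → U t * (G zero s t * product (λ i → G (suc i) (φ i) t))) ≡⟨ sum-cong-≗ (λ t → *-assoc (U t) (G zero s t) (product (λ i → G (suc i) (φ i) t))) ⟨
    sum (λ t → (U t * G zero s t) * product (λ i → G (suc i) (φ i) t)) ≤⟨ proj₂ (proj₂ rest) ⟩
    sum (λ t → U t * G zero s t)                                       ≤⟨ proj₂ (proj₂ first) ⟩
    sum U                                                              ∎

-- Deviations from a weighted mean and the size of the support.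

δ-diag : ∀ {n} (i : Fin n) → δ i i ≡ 1ℚ
δ-diag zero    = refl
δ-diag (suc i) = δ-diag i

δ-off : ∀ {n} {i j : Fin n} → i ≢ j → δ i j ≡ 0ℚ
δ-off {i = zero}  {zero}  i≢j = contradiction refl i≢j
δ-off {i = zero}  {suc j} i≢j = refl
δ-off {i = suc i} {zero}  i≢j = refl
δ-off {i = suc i} {suc j} i≢j = δ-off (i≢j ∘ cong suc)

sum-δ≡1 : ∀ {n} (i : Fin n) → sum (δ i) ≡ 1ℚ
sum-δ≡1 i = trans (sum-cong-≗ (λ j → sym (*-identityʳ (δ i j)))) (sum-δ i (λ _ → 1ℚ))

sg-≢0 : ∀ {x} → x ≢ 0ℚ → sg x ≡ 1ℚ
sg-≢0 {x} x≢0 with x ≟ 0ℚ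
... | yes x≡0 = contradiction x≡0 x≢0
... | no  _   = refl

≤sg : ∀ {x} → x ≤ 1ℚ → x ≤ sg x
≤sg {x} x≤1 with x ≟ 0ℚ
... | yes refl = ≤-refl
... | no  _   = x≤1

sum-minus : ∀ {n} (f g : Fin n → ℚ) → sum (λ i → f i - g i) ≡ sum f - sum g
sum-minus {zero}  f g = refl
sum-minus {suc n} f g = trans (cong (f zero - g zero +_) (sum-minus (f ∘ suc) (g ∘ suc)))
  (solve 4 (λ a b c d → (a :- b) :+ (c :- d) := (a :+ c) :- (b :+ d)) refl (f zero) (g zero) _ _)

dev : ∀ {k} (w c : Fin k → ℚ) → Fin k → ℚ
dev w c s = c s - sum (λ s′ → c s′ * w s′)

module _ {k} (w : Fin k → ℚ) (0≤w : ∀ s → 0ℚ ≤ w s) (Σw≡1 : sum w ≡ 1ℚ) where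

  mean≤1 : (f : Fin k → ℚ) → (∀ s → f s ≤ 1ℚ) → sum (λ s → w s * f s) ≤ 1ℚ
  mean≤1 f f≤1 = ≤-trans (sum-mono-≤ (λ s → ≤-trans (*-monoˡ-≤ (0≤w s) (f≤1 s)) (≤-reflexive (*-identityʳ (w s))))) (≤-reflexive Σw≡1)

  -- The entry at `s` contributes at most 0 and every other positive weight at most 1, as
  -- nonnegative weights with sum 1 are at most 1.
  mean≤support-1 : (f : Fin k → ℚ) → (∀ s → f s ≤ 1ℚ) → ∀ {s} → w s ≢ 0ℚ → f s ≤ 0ℚ →
                   sum (λ s → w s * f s) ≤ sum (sg ∘ w) - 1ℚ
  mean≤support-1 f f≤1 {s} wₛ≢0 fₛ≤0 = ≤-trans (sum-mono-≤ pointwise)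
    (≤-reflexive (trans (sum-minus (sg ∘ w) (δ s)) (cong (λ t → sum (sg ∘ w) - t) (sum-δ≡1 s))))
    where
    open ≤-Reasoning
    pointwise : ∀ s′ → w s′ * f s′ ≤ sg (w s′) - δ s s′
    pointwise s′ with s Fin.≟ s′
    ... | yes refl = begin
      w s * f s         ≤⟨ *-monoˡ-≤ (0≤w s) fₛ≤0 ⟩
      w s * 0ℚ          ≡⟨ *-zeroʳ (w s) ⟩
      1ℚ - 1ℚ           ≡⟨ cong₂ _-_ (sg-≢0 wₛ≢0) (δ-diag s) ⟨
      sg (w s) - δ s s  ∎
    ... | no s≢s′ = begin
      w s′ * f s′         ≤⟨ *-monoˡ-≤ (0≤w s′) (f≤1 s′) ⟩
      w s′ * 1ℚ           ≡⟨ *-identityʳ (w s′) ⟩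
      w s′                ≤⟨ ≤sg (≤-trans (term≤sum 0≤w s′) (≤-reflexive Σw≡1)) ⟩
      sg (w s′)           ≡⟨ +-identityʳ (sg (w s′)) ⟨
      sg (w s′) - 0ℚ      ≡⟨ cong (λ t → sg (w s′) - t) (δ-off s≢s′) ⟨
      sg (w s′) - δ s s′  ∎

  -- In this form the summand vanishes at `s′` = `s`, which provides the nonpositive entry that
  -- `mean≤support-1` requires.
  deviation-as-mean : (c : Fin k → ℚ) → ∀ s → sum (λ s′ → w s′ * (c s - c s′)) ≡ dev w c s
  deviation-as-mean c s = begin
    sum (λ s′ → w s′ * (c s - c s′))                       ≡⟨ sum-cong-≗ (λ s′ → solve 3 (λ w a b → w :* (a :- b) := a :* w :- b :* w) refl (w s′) (c s) (c s′)) ⟩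
    sum (λ s′ → c s * w s′ - c s′ * w s′)                  ≡⟨ sum-minus (λ s′ → c s * w s′) (λ s′ → c s′ * w s′) ⟩
    sum (λ s′ → c s * w s′) - sum (λ s′ → c s′ * w s′)     ≡⟨ cong (_- sum (λ s′ → c s′ * w s′)) (trans (sym (*-distribˡ-sum (c s) w)) (trans (cong (c s *_) Σw≡1) (*-identityʳ (c s)))) ⟩
    c s - sum (λ s′ → c s′ * w s′)                         ∎
    where open ≡-Reasoning

  module _ (c : Fin k → ℚ) (0≤c : ∀ s → 0ℚ ≤ c s) (c≤1 : ∀ s → c s ≤ 1ℚ) where

    private
      difference≤1 : ∀ s s′ → c s - c s′ ≤ 1ℚ
      difference≤1 s s′ = ≤-cert (p≤q⇒0≤q-p (c≤1 s) +≥0 0≤c s′)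
        (solve 2 (λ a b → con 1ℚ := (a :- b) :+ ((con 1ℚ :- a) :+ b)) refl (c s) (c s′))

      -dev-as-mean : ∀ s → sum (λ s′ → w s′ * (c s′ - c s)) ≡ - dev w c s
      -dev-as-mean s = trans (sum-cong-≗ (λ s′ → solve 3 (λ w a b → w :* (b :- a) := (:- con 1ℚ) :* (w :* (a :- b))) refl (w s′) (c s) (c s′)))
        (trans (sym (*-distribˡ-sum (- 1ℚ) (λ s′ → w s′ * (c s - c s′))))
        (trans (cong (- 1ℚ *_) (deviation-as-mean c s)) (solve 1 (λ x → (:- con 1ℚ) :* x := :- x) refl (dev w c s))))

    dev≤1 : ∀ s → dev w c s ≤ 1ℚ
    dev≤1 s = ≤-trans (≤-reflexive (sym (deviation-as-mean c s))) (mean≤1 _ (difference≤1 s))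

    -dev≤1 : ∀ s → - dev w c s ≤ 1ℚ
    -dev≤1 s = ≤-trans (≤-reflexive (sym (-dev-as-mean s))) (mean≤1 _ (λ s′ → difference≤1 s′ s))

    -- The deviation has absolute value at most 1, so its square is at most that absolute value,
    -- which is a mean of differences vanishing at `s`. A row with a single positive weight thus
    -- contributes no variance.
    dev²≤support-1 : ∀ {s} → w s ≢ 0ℚ → dev w c s * dev w c s ≤ sum (sg ∘ w) - 1ℚ
    dev²≤support-1 {s} wₛ≢0 with ≤-total 0ℚ (dev w c s)
    ... | inj₁ 0≤dev = begin
      dev w c s * dev w c s       ≤⟨ *-monoˡ-≤ 0≤dev (dev≤1 s) ⟩
      dev w c s * 1ℚ          ≡⟨ *-identityʳ (dev w c s) ⟩
      dev w c s               ≡⟨ deviation-as-mean c s ⟨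
      sum (λ s′ → w s′ * (c s - c s′)) ≤⟨ mean≤support-1 _ (difference≤1 s) wₛ≢0 (≤-reflexive (+-inverseʳ (c s))) ⟩
      sum (sg ∘ w) - 1ℚ   ∎
      where open ≤-Reasoning
    ... | inj₂ dev≤0 = begin
      dev w c s * dev w c s           ≡⟨ solve 1 (λ x → x :* x := (:- x) :* (:- x)) refl (dev w c s) ⟩
      (- dev w c s) * (- dev w c s)   ≤⟨ *-monoˡ-≤ (neg-antimono-≤ dev≤0) (-dev≤1 s) ⟩
      - dev w c s * 1ℚ            ≡⟨ *-identityʳ (- dev w c s) ⟩
      - dev w c s                 ≡⟨ -dev-as-mean s ⟨
      sum (λ s′ → w s′ * (c s′ - c s)) ≤⟨ mean≤support-1 _ (λ s′ → difference≤1 s′ s) wₛ≢0 (≤-reflexive (+-inverseʳ (c s))) ⟩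
      sum (sg ∘ w) - 1ℚ       ∎
      where open ≤-Reasoning

    mean-dev≡0 : sum (λ s → w s * dev w c s) ≡ 0ℚ
    mean-dev≡0 = begin
      sum (λ s → w s * (c s - p))          ≡⟨ sum-cong-≗ (λ s → solve 3 (λ w c p → w :* (c :- p) := c :* w :- p :* w) refl (w s) (c s) p) ⟩
      sum (λ s → c s * w s - p * w s)      ≡⟨ sum-minus (λ s → c s * w s) (λ s → p * w s) ⟩
      p - sum (λ s → p * w s)              ≡⟨ cong (λ t → p - t) (trans (sym (*-distribˡ-sum p w)) (trans (cong (p *_) Σw≡1) (*-identityʳ p))) ⟩
      p - p                                ≡⟨ +-inverseʳ p ⟩
      0ℚ                                   ∎
      where
      open ≡-Reasoning
      p = sum (λ s → c s * w s)

-- Exponential moment bound for the rounding.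

sum-exponents : ∀ {M} ε κ (a p g : Fin M → ℚ) →
                sum (λ i → ε * (a i - p i) - κ * (g i - 1ℚ)) ≡ ε * (sum a - sum p) - κ * (sum g - nat M)
sum-exponents {zero}  ε κ a p g = solve 2 (λ ε κ → con 0ℚ := ε :* (con 0ℚ :- con 0ℚ) :- κ :* (con 0ℚ :- con 0ℚ)) refl ε κ
sum-exponents {suc M} ε κ a p g = trans
  (cong (ε * (a zero - p zero) - κ * (g zero - 1ℚ) +_) (sum-exponents ε κ (a ∘ suc) (p ∘ suc) (g ∘ suc)))
  (trans
    (solve 9 (λ ε κ a p g A P G m → (ε :* (a :- p) :- κ :* (g :- con 1ℚ)) :+ (ε :* (A :- P) :- κ :* (G :- m))
        := ε :* ((a :+ A) :- (p :+ P)) :- κ :* ((g :+ G) :- (con 1ℚ :+ m)))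
      refl ε κ (a zero) (p zero) (g zero) (sum (a ∘ suc)) (sum (p ∘ suc)) (sum (g ∘ suc)) (nat M))
    (cong (λ t → ε * (sum a - sum p) - κ * (sum g - t)) (sym (nat-+ 1 M))))

-- A Chernoff bound in which the variance proxy is the number m of linear functionals instead of the
-- number M of coordinates: the weights have at most m positive entries beyond one per coordinate.
rounding-sparse :
  ∀ {M k m} (c : Fin m → Fin M → Fin k → ℚ) → (∀ t i s → 0ℚ ≤ c t i s) → (∀ t i s → c t i s ≤ 1ℚ) →
  (w : Fin M → Fin k → ℚ) → (∀ i s → 0ℚ ≤ w i s) → (∀ i → sum (w i) ≡ 1ℚ) →
  sum (λ i → sum (λ s → sg (w i s))) ≤ nat (M ℕ.+ m) →
  ∀ ε → 0ℚ ≤ ε → ε + ε ≤ 1ℚ →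
  ∃ λ (φ : Fin M → Fin k) → ∀ t x → 0ℚ ≤ x →
    x ≤ ε * (sum (λ i → c t i (φ i)) - sum (λ i → sum (λ s → c t i s * w i s))) - (ε * ε + ε * ε) * nat m →
    ExpLe x (nat m)
rounding-sparse {M} {k} {m} c 0≤c c≤1 w 0≤w Σw≡1 sg≤ ε 0≤ε 2ε≤1 =
  φ , λ t x 0≤x x≤ N → ≤-trans (expPartial≤product (h t) (f t) (h≤1 t) (0≤f t) (1≤f[1-h] t) 0≤x (≤-trans x≤ (ε-bound t)) N) (f≤m t)
  where
  open ≤-Reasoning
  κ : ℚ
  -- The factor 2 comes from (1 + εΔ)(1 - εΔ + κe) = 1 - ε²Δ² + κe(1 + εΔ): this is at least 1
  -- because Δ² ≤ e and 1 + εΔ ≥ ½.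
  κ = ε * ε + ε * ε
  0≤κ : 0ℚ ≤ κ
  0≤κ = 0≤ε *≥0 0≤ε +≥0 0≤ε *≥0 0≤ε

  D : Fin m → Fin M → Fin k → ℚ
  D t i = dev (w i) (c t i)
  G : Fin M → Fin k → Fin m → ℚ
  G i s t = 1ℚ + ε * D t i s
  mean≡1 : ∀ i t → sum (λ s → w i s * G i s t) ≡ 1ℚ
  mean≡1 i t = trans (sum-*-linearʳ (w i) (λ _ → 1ℚ) (D t i) ε)
    (trans (cong₂ (λ a b → a + ε * b) (trans (sum-cong-≗ (λ s → *-identityʳ (w i s))) (Σw≡1 i))
                                      (mean-dev≡0 (w i) (0≤w i) (Σw≡1 i) (c t i) (0≤c t i) (c≤1 t i)))
      (solve 1 (λ ε → con 1ℚ :+ ε :* con 0ℚ := con 1ℚ) refl ε))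
  rounded : ∃ λ (φ : Fin M → Fin k) → (∀ i → w i (φ i) ≢ 0ℚ) × sum {m} (λ t → 1ℚ * product (λ i → G i (φ i) t)) ≤ sum {m} (λ _ → 1ℚ)
  rounded = round M w G (λ _ → 1ℚ) 0≤w Σw≡1 mean≡1

  φ : Fin M → Fin k
  φ = proj₁ rounded
  Δ : Fin m → Fin M → ℚ
  Δ t i = D t i (φ i)
  e : Fin M → ℚ
  -- The excess support of row i; by the hypothesis on the support these excesses add up to at most
  -- m.
  e i = sum (sg ∘ w i) - 1ℚ
  h f : Fin m → Fin M → ℚ
  h t i = ε * Δ t i - κ * e i
  f t i = 1ℚ + ε * Δ t i

  0≤1-ε : 0ℚ ≤ 1ℚ - ε
  0≤1-ε = subst (0ℚ ≤_) (solve 1 (λ ε → (con 1ℚ :- (ε :+ ε)) :+ ε := con 1ℚ :- ε) refl ε) (p≤q⇒0≤q-p 2ε≤1 +≥0 0≤ε)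
  Δ²≤e : ∀ t i → Δ t i * Δ t i ≤ e i
  Δ²≤e t i = dev²≤support-1 (w i) (0≤w i) (Σw≡1 i) (c t i) (0≤c t i) (c≤1 t i) (proj₁ (proj₂ rounded) i)
  0≤1-Δ : ∀ t i → 0ℚ ≤ 1ℚ - Δ t i
  0≤1-Δ t i = p≤q⇒0≤q-p (dev≤1 (w i) (0≤w i) (Σw≡1 i) (c t i) (0≤c t i) (c≤1 t i) (φ i))
  0≤1+Δ : ∀ t i → 0ℚ ≤ 1ℚ - - Δ t i
  0≤1+Δ t i = p≤q⇒0≤q-p (-dev≤1 (w i) (0≤w i) (Σw≡1 i) (c t i) (0≤c t i) (c≤1 t i) (φ i))

  0≤x² : ∀ x → 0ℚ ≤ x * x
  0≤x² x with ≤-total 0ℚ x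
  ... | inj₁ 0≤x = 0≤x *≥0 0≤x
  ... | inj₂ x≤0 = subst (0ℚ ≤_) (solve 1 (λ x → (:- x) :* (:- x) := x :* x) refl x) (neg-antimono-≤ x≤0 *≥0 neg-antimono-≤ x≤0)

  -- A functional t is an argument because nonnegativity is read off from Δ² ≤ e.
  0≤e : Fin m → ∀ i → 0ℚ ≤ e i
  0≤e t i = ≤-trans (0≤x² (Δ t i)) (Δ²≤e t i)

  h≤1 : ∀ t i → h t i ≤ 1ℚ
  h≤1 t i = ≤-cert (0≤1-ε +≥0 0≤ε *≥0 0≤1-Δ t i +≥0 0≤κ *≥0 0≤e t i)
    (solve 4 (λ ε κ d e → con 1ℚ := (ε :* d :- κ :* e) :+ ((con 1ℚ :- ε) :+ ε :* (con 1ℚ :- d) :+ κ :* e)) refl ε κ (Δ t i) (e i))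

  0≤f : ∀ t i → 0ℚ ≤ f t i
  0≤f t i = subst (0ℚ ≤_) (solve 2 (λ ε d → (con 1ℚ :- ε) :+ ε :* (con 1ℚ :- (:- d)) := con 1ℚ :+ ε :* d) refl ε (Δ t i))
    (0≤1-ε +≥0 0≤ε *≥0 0≤1+Δ t i)

  1≤f[1-h] : ∀ t i → 1ℚ ≤ f t i * (1ℚ - h t i)
  1≤f[1-h] t i = ≤-cert
    (0≤ε *≥0 0≤ε *≥0 (p≤q⇒0≤q-p (Δ²≤e t i) +≥0 0≤e t i *≥0 (p≤q⇒0≤q-p 2ε≤1 +≥0 (0≤ε +≥0 0≤ε) *≥0 0≤1+Δ t i)))
    (solve 3 (λ ε d e → (con 1ℚ :+ ε :* d) :* (con 1ℚ :- (ε :* d :- (ε :* ε :+ ε :* ε) :* e))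
        := con 1ℚ :+ ε :* ε :* ((e :- d :* d) :+ e :* ((con 1ℚ :- (ε :+ ε)) :+ (ε :+ ε) :* (con 1ℚ :- (:- d)))))
      refl ε (Δ t i) (e i))

  -- Union bound: each product is one of the m nonnegative summands of a potential that starts at m
  -- and does not grow.
  f≤m : ∀ t → product (f t) ≤ nat m
  f≤m t = begin
    product (f t)                     ≤⟨ term≤sum (λ t′ → product-nonNeg (0≤f t′)) t ⟩
    sum (λ t′ → product (f t′))       ≡⟨ sum-cong-≗ (λ t′ → *-identityˡ (product (f t′))) ⟨
    sum (λ t′ → 1ℚ * product (f t′))  ≤⟨ proj₂ (proj₂ rounded) ⟩
    sum {m} (λ _ → 1ℚ)                ≡⟨ trans (sum-const m 1ℚ) (*-identityʳ (nat m)) ⟩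
    nat m                             ∎

  ε-bound : ∀ t → ε * (sum (λ i → c t i (φ i)) - sum (λ i → sum (λ s → c t i s * w i s))) - κ * nat m ≤ sum (h t)
  ε-bound t = begin
    ε * (A - F) - κ * nat m         ≤⟨ ≤-cert (0≤κ *≥0 p≤q⇒0≤q-p sg≤) certificate ⟩
    ε * (A - F) - κ * (E - nat M)   ≡⟨ sum-exponents ε κ (λ i → c t i (φ i)) (λ i → sum (λ s → c t i s * w i s)) (λ i → sum (sg ∘ w i)) ⟨
    sum (h t)                       ∎
    where
    A = sum (λ i → c t i (φ i))
    F = sum (λ i → sum (λ s → c t i s * w i s))
    E = sum (λ i → sum (sg ∘ w i))
    certificate : ε * (A - F) - κ * (E - nat M) ≡ ε * (A - F) - κ * nat m + κ * (nat (M ℕ.+ m) - E)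
    certificate = trans
      (solve 5 (λ a κ E M m → a :- κ :* (E :- M) := a :- κ :* m :+ κ :* ((M :+ m) :- E)) refl (ε * (A - F)) κ E (nat M) (nat m))
      (cong (λ t → ε * (A - F) - κ * nat m + κ * (t - E)) (sym (nat-+ M m)))

-- Sparsifying first keeps the row sums and all mean costs, so the bound for sparse weights holds
-- with the means of the original ones.
rounding :
  ∀ {M k m} (c : Fin m → Fin M → Fin k → ℚ) → (∀ t i s → 0ℚ ≤ c t i s) → (∀ t i s → c t i s ≤ 1ℚ) →
  (w : Fin M → Fin k → ℚ) → (∀ i s → 0ℚ ≤ w i s) → (∀ i → sum (w i) ≡ 1ℚ) →
  ∀ ε → 0ℚ ≤ ε → ε + ε ≤ 1ℚ →
  ∃ λ (φ : Fin M → Fin k) → ∀ t x → 0ℚ ≤ x →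
    x ≤ ε * (sum (λ i → c t i (φ i)) - sum (λ i → sum (λ s → c t i s * w i s))) - (ε * ε + ε * ε) * nat m →
    ExpLe x (nat m)
rounding {m = m} c 0≤c c≤1 w 0≤w Σw≡1 ε 0≤ε 2ε≤1 = let
    w′ , 0≤w′ , rows , costs , sg≤ = sparsify c w 0≤w
    φ , bound = rounding-sparse c 0≤c c≤1 w′ 0≤w′ (λ i → trans (rows i) (Σw≡1 i)) sg≤ ε 0≤ε 2ε≤1
  in φ , λ t x 0≤x x≤ → bound t x 0≤x
    (≤-trans x≤ (≤-reflexive (cong (λ F → ε * (sum (λ i → c t i (φ i)) - F) - (ε * ε + ε * ε) * nat m) (sym (costs t)))))

-- Choice of the parameter ε.

¼ : ℚ
¼ = (ℤ.+ 1) / 4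

0≤¼ : 0ℚ ≤ ¼
0≤¼ = nonNegative⁻¹ ¼

square-cancel-≤ : ∀ {a b} → 0ℚ ≤ b → a * a ≤ b * b → a ≤ b
square-cancel-≤ {a} {b} 0≤b a²≤b² with a ≤? b
... | yes a≤b = a≤b
... | no  a≰b = contradiction (begin-strict
  b * b  ≤⟨ *-monoʳ-≤ 0≤b (<⇒≤ b<a) ⟩
  a * b  <⟨ *-monoʳ-<-pos a {{ℚ.positive (≤-<-trans 0≤b b<a)}} b<a ⟩
  a * a  ≤⟨ a²≤b² ⟩
  b * b  ∎) (<-irrefl refl)
  where
  open ≤-Reasoning
  b<a = ≰⇒> a≰b

-- `K` stands for the number of points and `q` for its reciprocal; `D` = d/K is the guaranteed gap
-- between d and the mean distances.
module _ {K q d r : ℚ} (qK≡1 : q * K ≡ 1ℚ) (0≤q : 0ℚ ≤ q) (2≤K : nat 2 ≤ K) (0≤d : 0ℚ ≤ d) (0≤r : 0ℚ ≤ r)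
         (hyp : nat 8 * K * K * K * (r * r) ≤ d * d) where

  private
    D : ℚ
    D = d * q

    0≤D : 0ℚ ≤ D
    0≤D = 0≤d *≥0 0≤q

    0≤r² : 0ℚ ≤ r * r
    0≤r² = 0≤r *≥0 0≤r

    8Kr²≤D² : nat 8 * K * (r * r) ≤ D * D
    8Kr²≤D² = begin
      nat 8 * K * (r * r)                               ≡⟨ solve 2 (λ K r → con (nat 8) :* K :* (r :* r) := con (nat 8) :* (con 1ℚ :* con 1ℚ :* K) :* (r :* r)) refl K r ⟩
      nat 8 * (1ℚ * 1ℚ * K) * (r * r)                   ≡⟨ cong (λ u → nat 8 * (u * u * K) * (r * r)) qK≡1 ⟨
      nat 8 * (q * K * (q * K) * K) * (r * r)           ≡⟨ solve 3 (λ K q r → con (nat 8) :* (q :* K :* (q :* K) :* K) :* (r :* r) := (con (nat 8) :* K :* K :* K :* (r :* r)) :* (q :* q)) refl K q r ⟩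
      (nat 8 * K * K * K * (r * r)) * (q * q)           ≤⟨ *-monoʳ-≤ (0≤q *≥0 0≤q) hyp ⟩
      d * d * (q * q)                                   ≡⟨ solve 2 (λ d q → d :* d :* (q :* q) := (d :* q) :* (d :* q)) refl d q ⟩
      D * D                                             ∎
      where open ≤-Reasoning

    8r²≤D²q : nat 8 * (r * r) ≤ D * D * q
    8r²≤D²q = begin
      nat 8 * (r * r)                ≡⟨ solve 1 (λ r → con (nat 8) :* (r :* r) := con (nat 8) :* con 1ℚ :* (r :* r)) refl r ⟩
      nat 8 * 1ℚ * (r * r)           ≡⟨ cong (λ u → nat 8 * u * (r * r)) qK≡1 ⟨
      nat 8 * (q * K) * (r * r)      ≡⟨ solve 3 (λ K q r → con (nat 8) :* (q :* K) :* (r :* r) := con (nat 8) :* K :* (r :* r) :* q) refl K q r ⟩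
      nat 8 * K * (r * r) * q        ≤⟨ *-monoʳ-≤ 0≤q 8Kr²≤D² ⟩
      D * D * q                      ∎
      where open ≤-Reasoning

  -- As K ≥ 2, 16r² ≤ 8Kr² ≤ (d/K)².
  4r≤d/K : nat 4 * r ≤ d * q
  4r≤d/K = square-cancel-≤ 0≤D (≤-trans
    (≤-cert (0≤nat 8 *≥0 p≤q⇒0≤q-p 2≤K *≥0 0≤r²)
      (solve 2 (λ K r → con (nat 8) :* K :* (r :* r) := (con (nat 4) :* r) :* (con (nat 4) :* r) :+ con (nat 8) :* (K :- con (nat 2)) :* (r :* r)) refl K r))
    8Kr²≤D²)

  -- Because d/K ≥ 4r ≥ 4. The Chernoff argument ends in exp r ≤ K, and this turns it into a bound
  -- in terms of d.
  K≤d : 1ℚ ≤ r → K ≤ d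
  K≤d 1≤r = ≤-cert
    ((≤-trans (0≤nat 2) 2≤K) *≥0 (p≤q⇒0≤q-p 4r≤d/K +≥0 (0≤nat 4 *≥0 p≤q⇒0≤q-p 1≤r +≥0 0≤nat 3)))
    (begin
      d                                                       ≡⟨ *-identityʳ d ⟨
      d * 1ℚ                                                  ≡⟨ cong (d *_) qK≡1 ⟨
      d * (q * K)                                             ≡⟨ solve 4 (λ d q K r → d :* (q :* K) := K :+ K :* ((d :* q :- con (nat 4) :* r) :+ (con (nat 4) :* (r :- con 1ℚ) :+ con (nat 3)))) refl d q K r ⟩
      K + K * ((d * q - nat 4 * r) + (nat 4 * (r - 1ℚ) + nat 3)) ∎)
    where open ≡-Reasoning

  -- ε (d/K) − 2 ε² K is maximal at ε = d / 4K², where it equals (d/K)² / 8K; that choice is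
  -- capped at ε = ½.
  ε-choice : 1ℚ ≤ r → ∃ λ ε → 0ℚ ≤ ε × ε + ε ≤ 1ℚ × r ≤ ε * (d * q) - (ε * ε + ε * ε) * K
  ε-choice 1≤r with ≤-total D (nat 2 * K)
  ... | inj₁ D≤2K = ¼ * (D * q) , 0≤¼ *≥0 (0≤D *≥0 0≤q) ,
    ≤-cert (0≤½ *≥0 (p≤q⇒0≤q-p D≤2K *≥0 0≤q))
      (begin
        1ℚ                                                ≡⟨ qK≡1 ⟨
        q * K                                             ≡⟨ solve 3 (λ D q K → q :* K := (con ¼ :* (D :* q) :+ con ¼ :* (D :* q)) :+ con ½ :* ((con (nat 2) :* K :- D) :* q)) refl D q K ⟩
        (¼ * (D * q) + ¼ * (D * q)) + ½ * ((nat 2 * K - D) * q) ∎) ,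
    -- The value (d/K)²/8K is at least r², and r² ≥ r as r ≥ 1.
    ≤-cert (0≤⅛ *≥0 p≤q⇒0≤q-p 8r²≤D²q +≥0 0≤r *≥0 p≤q⇒0≤q-p 1≤r)
      (begin
        ε * D - (ε * ε + ε * ε) * K                       ≡⟨ solve 3 (λ D q K → let ε = con ¼ :* (D :* q) in ε :* D :- (ε :* ε :+ ε :* ε) :* K := con ¼ :* (D :* D :* q) :- con ⅛ :* (D :* D :* q) :* (q :* K)) refl D q K ⟩
        ¼ * (D * D * q) - ⅛ * (D * D * q) * (q * K)       ≡⟨ cong (λ u → ¼ * (D * D * q) - ⅛ * (D * D * q) * u) qK≡1 ⟩
        ¼ * (D * D * q) - ⅛ * (D * D * q) * 1ℚ            ≡⟨ solve 2 (λ x r → con ¼ :* x :- con ⅛ :* x :* con 1ℚ := r :+ (con ⅛ :* (x :- con (nat 8) :* (r :* r)) :+ r :* (r :- con 1ℚ))) refl (D * D * q) r ⟩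
        r + (⅛ * (D * D * q - nat 8 * (r * r)) + r * (r - 1ℚ)) ∎)
    where
    open ≡-Reasoning
    ⅛ : ℚ
    ⅛ = (ℤ.+ 1) / 8
    0≤⅛ : 0ℚ ≤ ⅛
    0≤⅛ = nonNegative⁻¹ ⅛
    ε = ¼ * (D * q)
  ... | inj₂ 2K≤D = ½ , 0≤½ , ≤-refl ,
    -- At ε = ½ the value is D/2 - K/2, which is at least r because D ≥ 4r and D ≥ 2K.
    ≤-cert (0≤¼ *≥0 (p≤q⇒0≤q-p 4r≤d/K +≥0 p≤q⇒0≤q-p 2K≤D))
      (solve 3 (λ D K r → con ½ :* D :- (con ½ :* con ½ :+ con ½ :* con ½) :* K
          := r :+ con ¼ :* ((D :- con (nat 4) :* r) :+ (D :- con (nat 2) :* K))) refl D K r)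

-- Counting mismatches

∈-─⁺ : ∀ {x y : ℕ} {ys} (x∈ys : x ∈ₗ ys) → y ∈ₗ ys → y ≢ x → y ∈ₗ (ys ─ x∈ys)
∈-─⁺ (here refl)  (here refl)  y≢x = contradiction refl y≢x
∈-─⁺ (here refl)  (there y∈ys) y≢x = y∈ys
∈-─⁺ (there x∈ys) (here refl)  y≢x = here refl
∈-─⁺ (there x∈ys) (there y∈ys) y≢x = there (∈-─⁺ x∈ys y∈ys y≢x)

Unique-⊆-length : ∀ {xs ys : List ℕ} → Unique xs → (∀ {x} → x ∈ₗ xs → x ∈ₗ ys) → length xs ℕ.≤ length ys
Unique-⊆-length {[]}     _           _  = z≤n
Unique-⊆-length {x ∷ xs} {ys} (x∉xs ∷ xs!) ⊆ = subst (suc (length xs) ℕ.≤_) (sym (length-removeAt′ ys (index x∈ys)))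
  (s≤s (Unique-⊆-length xs! (λ y∈xs → ∈-─⁺ x∈ys (⊆ (there y∈xs)) (λ y≡x → All.lookup x∉xs y∈xs (sym y≡x)))))
  where
  x∈ys : x ∈ₗ ys
  x∈ys = ⊆ (here refl)

ind : ∀ {P : Set} → Dec P → ℚ
ind P? = if does P? then 1ℚ else 0ℚ

0≤ind : ∀ {P : Set} (P? : Dec P) → 0ℚ ≤ ind P?
0≤ind (yes _) = 0≤1
0≤ind (no _)  = ≤-refl

ind≤1 : ∀ {P : Set} (P? : Dec P) → ind P? ≤ 1ℚ
ind≤1 (yes _) = ≤-refl
ind≤1 (no _)  = 0≤1

ind-no : ∀ {P : Set} (P? : Dec P) → ¬ P → ind P? ≡ 0ℚ
ind-no (yes p) ¬p = contradiction p ¬p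
ind-no (no _)  _  = refl

nat-length-filter : ∀ {P : Pred ℕ 0ℓ} (P? : Decidable P) (f : ℕ → ℕ) M →
                    nat (length (filter P? (applyUpTo f M))) ≡ sum {M} (λ i → ind (P? (f (toℕ i))))
nat-length-filter P? f zero    = refl
nat-length-filter P? f (suc M) with P? (f 0)
... | yes _ = trans (nat-+ 1 (length (filter P? (applyUpTo (f ∘ suc) M)))) (cong (1ℚ +_) (nat-length-filter P? (f ∘ suc) M))
... | no  _ = trans (nat-length-filter P? (f ∘ suc) M) (sym (+-identityˡ _))

module _ {n : ℕ} where

  differ? : (a b : Seq n) → Decidable (λ i → a i ≢ b i)
  differ? a b i = ¬? (a i Fin.≟ b i)

  diffs : ℕ → Seq n → Seq n → List ℕ
  diffs M a b = filter (differ? a b) (upTo M)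

  nat-length-diffs : ∀ M a b → nat (length (diffs M a b)) ≡ sum {M} (λ i → ind (differ? a b (toℕ i)))
  nat-length-diffs M a b = nat-length-filter (differ? a b) id M

  DistLe⇒length-diffs≤ : ∀ {a b : Seq n} {d} M → DistLe a b d → length (diffs M a b) ℕ.≤ d
  DistLe⇒length-diffs≤ {a} {b} M a~b = a~b (diffs M a b) (Unique.filter⁺ (differ? a b) (Unique.upTo⁺ M)) (all-filter (differ? a b) (upTo M))

  -- Mismatches below M are counted by `diffs` and there are none above M; position M itself may add
  -- one more, hence the strict inequality.
  length-diffs<⇒DistLe : ∀ {a b : Seq n} {d M} → (∀ i → M ℕ.< i → a i ≡ b i) → length (diffs M a b) ℕ.< d → DistLe a b d
  length-diffs<⇒DistLe {a} {b} {d} {M} agree <d is is! is≢ = ℕ.≤-trans (Unique-⊆-length is! is⊆) <d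
    where
    is⊆ : ∀ {i} → i ∈ₗ is → i ∈ₗ (M ∷ diffs M a b)
    is⊆ {i} i∈is with ℕ.<-cmp i M
    ... | tri< i<M _ _ = there (∈-filter⁺ (differ? a b) (∈-upTo⁺ i<M) (All.lookup is≢ i∈is))
    ... | tri≈ _ i≡M _ = here i≡M
    ... | tri> _ _ M<i = contradiction (agree i M<i) (All.lookup is≢ i∈is)

  DistLe-sym : ∀ {a b : Seq n} {d} → DistLe a b d → DistLe b a d
  DistLe-sym a~b is is! is≢ = a~b is is! (All.map (λ b≢a → b≢a ∘ sym) is≢)

  DistLe-resp-≗ : ∀ {a a′ b b′ : Seq n} {d} → a ≗ a′ → b ≗ b′ → DistLe a b d → DistLe a′ b′ d
  DistLe-resp-≗ a≗a′ b≗b′ a~b is is! is≢ =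
    a~b is is! (All.map (λ {i} a′≢b′ a≡b → a′≢b′ (trans (sym (a≗a′ i)) (trans a≡b (b≗b′ i)))) is≢)

  DistLe-refl : ∀ {a : Seq n} {d} → DistLe a a d
  DistLe-refl []       _ _         = z≤n
  DistLe-refl (i ∷ is) _ (a≢a ∷ _) = contradiction refl a≢a

  -- Induction on the number e of mismatches still possible from p on: one found at i ≥ p uses up
  -- one of them, and the search resumes beyond i. Whether there is one cannot be decided, hence the
  -- double negation.
  agree-eventually : ∀ (a b : Seq n) e p →
    (∀ is → Unique is → All (λ i → a i ≢ b i) is → All (p ℕ.≤_) is → length is ℕ.≤ e) →
    ¬ ¬ (∃ λ M → ∀ i → M ℕ.≤ i → a i ≡ b i)
  agree-eventually a b zero p few k = k (p , λ i p≤i → decidable-stable (a i Fin.≟ b i) λ a≢b →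
    contradiction (few (i ∷ []) ([] ∷ []) (a≢b ∷ []) (p≤i ∷ [])) λ ())
  agree-eventually a b (suc e) p few k = ¬¬-excluded-middle {A = ∃ λ i → p ℕ.≤ i × a i ≢ b i} λ
    { (no none) → k (p , λ i p≤i → decidable-stable (a i Fin.≟ b i) λ a≢b → none (i , p≤i , a≢b))
    ; (yes (i , p≤i , a≢b)) → agree-eventually a b e (suc i) (λ is is! is≢ i<is → ℕ.s≤s⁻¹
        (few (i ∷ is) (All.map ℕ.<⇒≢ i<is ∷ is!) (a≢b ∷ is≢) (p≤i ∷ All.map (λ i<j → ℕ.≤-trans p≤i (ℕ.<⇒≤ i<j)) i<is))) k
    }

  all-agree-eventually : ∀ {d} k (A : Fin k → Seq n) (a₀ : Seq n) → (∀ j → DistLe (A j) a₀ d) →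
                         ¬ ¬ (∃ λ M → ∀ j i → M ℕ.≤ i → A j i ≡ a₀ i)
  all-agree-eventually zero    A a₀ A~a₀ k = k (0 , λ ())
  all-agree-eventually {d} (suc m) A a₀ A~a₀ k =
    agree-eventually (A zero) a₀ d 0 (λ is is! is≢ _ → A~a₀ zero is is! is≢) λ (M₀ , agree₀) →
    all-agree-eventually m (A ∘ suc) a₀ (A~a₀ ∘ suc) λ (M , agree) →
    k (M₀ ⊔ M , λ
      { zero    i M≤i → agree₀ i (ℕ.≤-trans (ℕ.m≤m⊔n M₀ M) M≤i)
      ; (suc j) i M≤i → agree j i (ℕ.≤-trans (ℕ.m≤n⊔m M₀ M) M≤i)
      })

  -- The letter at M is left free: once it differs from the letter shared there by all `A j`, the
  -- spliced sequence equals none of them, whatever `φ` is.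
  splice : ∀ {k} M (A : Fin k → Seq n) (φ : Fin M → Fin k) (v : Fin n) (a₀ : Seq n) → Seq n
  splice M A φ v a₀ i with i ℕ.<? M | i ℕ.≟ M
  ... | yes i<M | _     = A (φ (fromℕ< i<M)) i
  ... | no _    | yes _ = v
  ... | no _    | no _  = a₀ i

  module _ {k} M (A : Fin k → Seq n) (φ : Fin M → Fin k) (v : Fin n) (a₀ : Seq n) where

    splice-below : ∀ i → splice M A φ v a₀ (toℕ i) ≡ A (φ i) (toℕ i)
    splice-below i with toℕ i ℕ.<? M | toℕ i ℕ.≟ M
    ... | yes i<M | _ = cong (λ j → A (φ j) (toℕ i)) (Fin.fromℕ<-toℕ i i<M)
    ... | no  i≮M | _ = contradiction (Fin.toℕ<n i) i≮M

    splice-at : splice M A φ v a₀ M ≡ v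
    splice-at with M ℕ.<? M | M ℕ.≟ M
    ... | yes M<M | _       = contradiction M<M (ℕ.<-irrefl refl)
    ... | no _    | yes _   = refl
    ... | no _    | no M≢M  = contradiction refl M≢M

    splice-above : ∀ i → M ℕ.< i → splice M A φ v a₀ i ≡ a₀ i
    splice-above i M<i with i ℕ.<? M | i ℕ.≟ M
    ... | yes i<M | _        = contradiction i<M (ℕ.<-asym M<i)
    ... | no _    | yes refl = contradiction M<i (ℕ.<-irrefl refl)
    ... | no _    | no _     = refl

-- The bound for a finite unextendable family.

module Family {n d k₁ : ℕ} (A : Fin (suc k₁) → Seq n) (2≤k : 2 ℕ.≤ suc k₁)
  (a₀ : Seq n) (M : ℕ) (agree : ∀ j i → M ℕ.≤ i → A j i ≡ a₀ i) (v : Fin n) (v≢a₀ : v ≢ a₀ M)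
  (close : ∀ s t → DistLe (A s) (A t) d)
  (unextendable : ∀ y → (∀ t → DistLe y (A t) d) → ∃ λ j → ∀ i → A j i ≡ y i) where

  private
    k : ℕ
    k = suc k₁

  c : Fin k → Fin M → Fin k → ℚ
  c t i s = ind (differ? (A s) (A t) (toℕ i))

  q : ℚ
  q = 1/suc k₁

  K*q≡1 : nat k * q ≡ 1ℚ
  K*q≡1 = trans (*-comm (nat k) q) (1/suc-inverse k₁)

  -- On the first M coordinates each `A s` has distance at most d to `A t`, and `A t` itself has
  -- distance 0, so the uniform mean is at most d - d/k.
  mean-cost : ∀ t → nat d * q ≤ nat d - sum (λ i → sum (λ s → c t i s * q))
  mean-cost t = begin
    nat d * q                                       ≡⟨ solve 2 (λ d q → d :* q := d :* q :- con 0ℚ :* q) refl (nat d) q ⟩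
    nat d * q - 0ℚ * q                              ≡⟨ cong (λ u → nat d * q - u * q) Hₜ≡0 ⟨
    nat d * q - H t * q                             ≤⟨ term≤sum (λ s → p≤q⇒0≤q-p (*-monoʳ-≤ (0≤1/suc k₁) (H≤d s))) t ⟩
    sum (λ s → nat d * q - H s * q)                 ≡⟨ sum-minus {k} (λ _ → nat d * q) (λ s → H s * q) ⟩
    sum {k} (λ _ → nat d * q) - sum (λ s → H s * q) ≡⟨ cong₂ _-_ Σdq≡d ΣHq≡F ⟩
    nat d - sum (λ i → sum (λ s → c t i s * q))     ∎
    where
    open ≤-Reasoning
    H : Fin k → ℚ
    H s = sum (λ i → c t i s)
    Hₜ≡0 : H t ≡ 0ℚ
    Hₜ≡0 = trans (sum-cong-≗ {M} (λ i → ind-no (differ? (A t) (A t) (toℕ i)) (λ a≢a → a≢a refl))) (sum-replicate-zero M)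
    H≤d : ∀ s → H s ≤ nat d
    H≤d s = ≤-trans (≤-reflexive (sym (nat-length-diffs M (A s) (A t)))) (nat-mono-≤ (DistLe⇒length-diffs≤ M (close s t)))
    Σdq≡d : sum {k} (λ _ → nat d * q) ≡ nat d
    Σdq≡d = trans (sum-const k (nat d * q)) (trans (solve 3 (λ K d q → K :* (d :* q) := d :* (K :* q)) refl (nat k) (nat d) q)
      (trans (cong (nat d *_) K*q≡1) (*-identityʳ (nat d))))
    ΣHq≡F : sum (λ s → H s * q) ≡ sum (λ i → sum (λ s → c t i s * q))
    ΣHq≡F = trans (sum-cong-≗ (λ s → *-distribʳ-sum q (λ i → c t i s))) (∑-comm (λ s i → c t i s * q))

  -- If the spliced sequence had fewer than d mismatches below M with every `A t`, it would be
  -- within d of all of them and hence, by unextendability, equal to one; but its letter at M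
  -- forbids this.
  far-point : (φ : Fin M → Fin k) → ∃ λ t → nat d ≤ sum (λ i → c t i (φ i))
  far-point φ with Fin.¬∀⟶∃¬ k (λ t → length (diffs M y (A t)) ℕ.< d) (λ t → length (diffs M y (A t)) ℕ.<? d) not-all-near
    where
    y : Seq n
    y = splice M A φ v a₀
    not-all-near : ¬ (∀ t → length (diffs M y (A t)) ℕ.< d)
    not-all-near near with unextendable y (λ t → length-diffs<⇒DistLe
      (λ i M<i → trans (splice-above M A φ v a₀ i M<i) (sym (agree t i (ℕ.<⇒≤ M<i)))) (near t))
    ... | j , Aⱼ≗y = v≢a₀ (trans (sym (splice-at M A φ v a₀)) (trans (sym (Aⱼ≗y M)) (agree j M ℕ.≤-refl)))
  ... | t , ≮d = t , (begin
    nat d                                                        ≤⟨ nat-mono-≤ (ℕ.≮⇒≥ ≮d) ⟩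
    nat (length (diffs M (splice M A φ v a₀) (A t)))             ≡⟨ nat-length-diffs M (splice M A φ v a₀) (A t) ⟩
    sum {M} (λ i → ind (differ? (splice M A φ v a₀) (A t) (toℕ i))) ≡⟨ sum-cong-≗ (λ i → cong (λ u → ind (¬? (u Fin.≟ A t (toℕ i)))) (splice-below M A φ v a₀ i)) ⟩
    sum (λ i → c t i (φ i))                                      ∎)
    where open ≤-Reasoning

  module _ {r : ℚ} (0≤r : 0ℚ ≤ r) (hyp : nat (8 ℕ.* k ℕ.* k ℕ.* k) * (r * r) ≤ nat (d ℕ.* d)) where

    private
      hyp′ : nat 8 * nat k * nat k * nat k * (r * r) ≤ nat d * nat d
      hyp′ = subst₂ _≤_
        (cong (_* (r * r)) (trans (nat-* (8 ℕ.* k ℕ.* k) k) (cong (_* nat k) (trans (nat-* (8 ℕ.* k) k) (cong (_* nat k) (nat-* 8 k))))))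
        (nat-* d d) hyp

      2≤K : nat 2 ≤ nat k
      2≤K = nat-mono-≤ 2≤k

    -- For d = 1, r ≤ 4r ≤ 1/k ≤ ½ and exp ½ ≤ 2; for d ≥ 2, exp 1 ≤ 4 ≤ 2d.
    small : r ≤ 1ℚ → d ≥ 1 → ExpLe r (nat (2 ℕ.* d))
    small r≤1 (s≤s {n = zero} _) N = ≤-trans (expPartial-mono-≤ 0≤r r≤½ N) (expPartial-½-≤-2 N)
      where
      open ≤-Reasoning
      r≤½ : r ≤ ½
      r≤½ = begin
        r                      ≤⟨ ≤-cert (0≤nat 3 *≥0 0≤r) (solve 1 (λ r → con (nat 4) :* r := r :+ con (nat 3) :* r) refl r) ⟩
        nat 4 * r              ≤⟨ 4r≤d/K (1/suc-inverse k₁) (0≤1/suc k₁) 2≤K (0≤nat 1) 0≤r hyp′ ⟩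
        nat 1 * q              ≡⟨ solve 1 (λ q → con (nat 1) :* q := con ½ :* (q :* con (nat 2))) refl q ⟩
        ½ * (q * nat 2)        ≤⟨ *-monoˡ-≤ 0≤½ (*-monoˡ-≤ (0≤1/suc k₁) 2≤K) ⟩
        ½ * (q * nat k)        ≡⟨ cong (½ *_) (1/suc-inverse k₁) ⟩
        ½ * 1ℚ                 ≡⟨ *-identityʳ ½ ⟩
        ½                      ∎
    small r≤1 (s≤s {n = suc d₂} _) N = ≤-trans (expPartial-mono-≤ 0≤r r≤1 N)
      (≤-trans (expPartial-1-≤-4 N) (nat-mono-≤ (ℕ.*-monoʳ-≤ 2 (s≤s (s≤s (z≤n {d₂}))))))

    -- The rounded point has at least d mismatches with some `A t`, so it overshoots the mean by at
    -- least d/k; the Chernoff bound then gives exp r ≤ k ≤ d ≤ 2d.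
    large : 1ℚ ≤ r → ExpLe r (nat (2 ℕ.* d))
    large 1≤r N = let
        ε , 0≤ε , 2ε≤1 , r≤ = ε-choice (1/suc-inverse k₁) (0≤1/suc k₁) 2≤K (0≤nat d) 0≤r hyp′ 1≤r
        φ , bound = rounding c (λ t i s → 0≤ind (differ? (A s) (A t) (toℕ i))) (λ t i s → ind≤1 (differ? (A s) (A t) (toℕ i)))
                      (λ _ _ → q) (λ _ _ → 0≤1/suc k₁) (λ _ → trans (sum-const k q) K*q≡1) ε 0≤ε 2ε≤1
        t , d≤X = far-point φ
        slack : nat d * q ≤ sum (λ i → c t i (φ i)) - sum (λ i → sum (λ s → c t i s * q))
        slack = ≤-trans (mean-cost t) (+-monoˡ-≤ (- sum (λ i → sum (λ s → c t i s * q))) d≤X)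
      in ≤-trans (bound t r 0≤r (≤-trans r≤ (+-monoˡ-≤ (- ((ε * ε + ε * ε) * nat k)) (*-monoˡ-≤ 0≤ε slack))) N)
        (≤-trans (K≤d (1/suc-inverse k₁) (0≤1/suc k₁) 2≤K (0≤nat d) 0≤r hyp′ 1≤r) (nat-mono-≤ (ℕ.m≤n*m d 2)))

    bound : d ≥ 1 → ExpLe r (nat (2 ℕ.* d))
    bound d≥1 with ≤-total r 1ℚ
    ... | inj₁ r≤1 = small r≤1 d≥1
    ... | inj₂ 1≤r = large 1≤r

bound-of-family :
  ∀ {n d k} (A : Fin k → Seq n) → 2 ℕ.≤ k → (a₀ : Seq n) (M : ℕ) → (∀ j i → M ℕ.≤ i → A j i ≡ a₀ i) →
  {v : Fin n} → v ≢ a₀ M → (∀ s t → DistLe (A s) (A t) d) →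
  (∀ y → (∀ t → DistLe y (A t) d) → ∃ λ j → ∀ i → A j i ≡ y i) →
  ∀ {r} → 0ℚ ≤ r → nat (8 ℕ.* k ℕ.* k ℕ.* k) * (r * r) ≤ nat (d ℕ.* d) → d ≥ 1 → ExpLe r (nat (2 ℕ.* d))
bound-of-family {k = suc _} A 2≤k a₀ M agree v≢a₀ close unextendable =
  Family.bound A 2≤k a₀ M agree _ v≢a₀ close unextendable

-- From a maximal set to a finite family.

members : ∀ {n} (S : Pred (Seq n) 0ℓ) (xs : List (Seq n)) →
          ¬ ¬ (∃ λ ys → All (_∈ S) ys × length ys ℕ.≤ length xs × (∀ a → a ∈ S → Any (λ x → ∀ i → x i ≡ a i) xs → Any (λ y → ∀ i → y i ≡ a i) ys))
members S []       k = k ([] , [] , z≤n , λ _ _ ())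
members S (x ∷ xs) k = members S xs λ (ys , ys⊆S , len , cover) →
  ¬¬-excluded-middle {A = ∃ λ b → b ∈ S × (∀ i → x i ≡ b i)} λ
    -- `x` is replaced by the member `b`, since membership in `S` need not respect pointwise
    -- equality.
    { (yes (b , b∈S , x≗b)) → k (b ∷ ys , b∈S ∷ ys⊆S , s≤s len , λ
        { a a∈S (here x≗a)  → here (λ i → trans (sym (x≗b i)) (x≗a i))
        ; a a∈S (there any) → there (cover a a∈S any)
        })
    -- `x` covers no member of `S` and is dropped.
    ; (no x∉S) → k (ys , ys⊆S , ℕ.m≤n⇒m≤1+n len , λ
        { a a∈S (here x≗a)  → contradiction (a , a∈S , x≗a) x∉S
        ; a a∈S (there any) → cover a a∈S any
        })
    }

≢⇒2≤ : ∀ {k} {i j : Fin k} → i ≢ j → 2 ℕ.≤ k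
≢⇒2≤ {suc zero}    {zero} {zero} i≢j = contradiction refl i≢j
≢⇒2≤ {suc (suc k)}               _   = s≤s (s≤s z≤n)

other-letter : ∀ {n} {u v : Fin n} → u ≢ v → ∀ z → ∃ λ w → w ≢ z
other-letter {u = u} {v} u≢v z with u Fin.≟ z
... | yes refl = v , u≢v ∘ sym
... | no  u≢z  = u , u≢z

-- Adjoining to `S` all sequences pointwise equal to `y` keeps the diameter: the new distances are
-- at most d, and the pair at distance d is still there. Maximality then puts `y` into `S`.
maximal⇒unextendable : ∀ {n d} {S : Pred (Seq n) 0ℓ} → Maximal S d →
                       ∀ y → (∀ a → a ∈ S → DistLe y a d) → y ∈ S
maximal⇒unextendable {d = d} {S} ((close , a , b , a∈S , b∈S , far) , max) y y~S =
  max T inj₁ (T-close , a , b , inj₁ a∈S , inj₁ b∈S , far) (inj₂ (λ _ → refl))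
  where
  T : Pred (Seq _) 0ℓ
  T x = x ∈ S ⊎ (∀ i → y i ≡ x i)
  T-close : ∀ x z → x ∈ T → z ∈ T → DistLe x z d
  T-close x z (inj₁ x∈S) (inj₁ z∈S) = close x z x∈S z∈S
  T-close x z (inj₁ x∈S) (inj₂ y≗z) = DistLe-sym (DistLe-resp-≗ y≗z (λ _ → refl) (y~S x x∈S))
  T-close x z (inj₂ y≗x) (inj₁ z∈S) = DistLe-resp-≗ y≗x (λ _ → refl) (y~S z z∈S)
  T-close x z (inj₂ y≗x) (inj₂ y≗z) = DistLe-resp-≗ y≗x y≗z DistLe-refl

theorem6 : (n d : ℕ) → n ≥ 1 → d ≥ 1 → (S : Pred (ℕ → Fin n) 0ℓ) → Maximal S d →
    (k : ℕ) → CoveredBy S k → AtLeastBound k d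
theorem6 n d n≥1 d≥1 S maximal@((close , a , b , a∈S , b∈S , is , _ , is≢ , refl) , _) k (xs , refl , cover) r 0≤r hyp N =
  decidable-stable (expPartial r N ≤? nat (2 ℕ.* d)) λ ¬goal →
  members S xs λ (ys , ys⊆S , len≤ , cover′) →
  all-agree-eventually (length ys) (lookup ys) a (λ j → close _ _ (All.lookup ys⊆S (∈-lookup j)) a∈S) λ (M , agree) →
  ¬goal (conclude ys ys⊆S len≤ (λ x x∈S → cover′ x x∈S (cover x x∈S)) M agree)
  where
  different : ∀ is → length is ℕ.≥ 1 → All (λ i → a i ≢ b i) is → ∃ λ p → a p ≢ b p
  different (p ∷ _) _ (a≢b ∷ _) = p , a≢b

  conclude : ∀ ys → All (_∈ S) ys → length ys ℕ.≤ length xs → (∀ x → x ∈ S → Any (λ y → ∀ i → y i ≡ x i) ys) →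
             ∀ M → (∀ j i → M ℕ.≤ i → lookup ys j i ≡ a i) → expPartial r N ≤ nat (2 ℕ.* d)
  conclude ys ys⊆S len≤ cover′ M agree = bound-of-family (lookup ys) (≢⇒2≤ ja≢jb) a M agree
    (proj₂ letter) (λ s t → close _ _ (member s) (member t)) unextendable 0≤r
    -- The family is no longer than the cover and 8k³r² grows with k, so the hypothesis passes to
    -- the family.
    (≤-trans (*-monoʳ-≤ (0≤r *≥0 0≤r) (nat-mono-≤ (ℕ.*-mono-≤ (ℕ.*-mono-≤ (ℕ.*-monoʳ-≤ 8 len≤) len≤) len≤))) hyp) d≥1 N
    where
    member : ∀ j → lookup ys j ∈ S
    member j = All.lookup ys⊆S (∈-lookup j)
    p : ℕ
    p = proj₁ (different is d≥1 is≢)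
    a≢b : a p ≢ b p
    a≢b = proj₂ (different is d≥1 is≢)
    -- As d ≥ 1, `a` and `b` differ somewhere, so the alphabet has a letter other than `a M`.
    letter : ∃ λ v → v ≢ a M
    letter = other-letter a≢b (a M)
    -- The entries representing `a` and `b` differ at `p`, so the family has at least two entries.
    ja≢jb : index (cover′ a a∈S) ≢ index (cover′ b b∈S)
    ja≢jb eq = a≢b (trans (sym (lookup-index (cover′ a a∈S) p)) (trans (cong (λ j → lookup ys j p) eq) (lookup-index (cover′ b b∈S) p)))
    unextendable : ∀ y → (∀ t → DistLe y (lookup ys t) d) → ∃ λ j → ∀ i → lookup ys j i ≡ y i
    unextendable y y~ys = index (cover′ y y∈S) , lookup-index (cover′ y y∈S)
      where
      y∈S : y ∈ S
      y∈S = maximal⇒unextendable maximal y λ x x∈S →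
        DistLe-resp-≗ (λ _ → refl) (lookup-index (cover′ x x∈S)) (y~ys (index (cover′ x x∈S)))
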